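{- If $G$ is a $2$-tree, then $\mathrm{pind}(A_G)=1$, and hence $G$ is $(2,2)$-choosable.
   Context: Graphs are finite and simple. A graph $G$ is a $2$-tree if there is an acyclic orientation of $G$ such that: (1) there are two adjacent vertices $v_0,v_1$ with out-degrees $d^+(v_0)=0$ and $d^+(v_1)=1$; (2) every other vertex $v$ has out-degree $d^+(v)=2$, and the two out-neighbours of $v$ are adjacent. The matrix $A_G$: fix an orientation of $G$. $A_G$ is the real matrix with rows indexed by $E(G)$ and columns indexed by $V(G)\cup E(G)$, where for an edge $e$ oriented from $a$ to $b$: $A_G[e,z]=1$ if $z=b$ or $z\neq e$ is an edge incident to $b$; $A_G[e,z]=-1$ if $z=a$ or $z\ne e$ is an edge incident to $a$; and $A_G[e,z]=0$ otherwise. (Changing the orientation only multiplies rows by $-1$, so the notion below does not depend on it.) The permanent of an $m\times m$ matrix $A$ is $\mathrm{per}(A)=\sum_{\sigma\in S_m}\prod_{i=1}^m A[i,\sigma(i)]$. The permanent index $\mathrm{pind}(A)$ of a matrix $A$ is the minimum integer $k$ such that there is a square matrix $A'$ (with the same rows as $A$) with $\mathrm{per}(A')\ne0$, each column of $A'$ is a column of $A$, and each column of $A$ (identified by its column index) occurs in $A'$ at most $k$ times; if no such $k$ exists, $\mathrm{pind}(A)=\infty$. A total weighting of $G$ is a map $f:V(G)\cup E(G)\to\mathbb{R}$; the vertex sum of $v$ is $\phi_f(v)=f(v)+\sum_{e\in E(v)}f(e)$, where $E(v)$ is the set of edges incident to $v$. It is proper if $\phi_f(u)\neq\phi_f(v)$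 for every edge $uv$ of $G$. $G$ is $(k,k')$-choosable if for every assignment $L$ of a set $L(v)$ of $k$ real numbers to each vertex $v$ and a set $L(e)$ of $k'$ real numbers to each edge $e$, there is a proper total weighting $f$ with $f(z)\in L(z)$ for all $z\in V(G)\cup E(G)$. -}

module Defs where

open import Algebra.Apartness.Bundles using (HeytingField)
import Algebra.Definitions.RawMonoid as RawMonoidDefs
open import Algebra.Bundles using (CommutativeRing)
open import Data.Bool.Base using (if_then_else_)
open import Data.Fin.Base using (Fin; zero)
open import Data.Fin.Permutation using (Permutation′; _⟨$⟩ʳ_; insert; id)
open import Data.Fin.Properties using (_≟_)
open import Data.List.Base using (List; []; _∷_; map; foldr; concatMap; filter; length; allFin)
open import Data.Nat.Base using (ℕ; zero; suc; _≤_)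
open import Data.Product.Base using (Σ; ∃; ∃-syntax; _×_)
open import Data.Sum.Base using (_⊎_; inj₁; inj₂)
open import Data.Sum.Properties using (≡-dec)
open import Function.Bundles using (_⇔_)
open import Level using (Level; 0ℓ; _⊔_) renaming (suc to lsuc)
open import Relation.Binary.Construct.Closure.Transitive using (TransClosure)
open import Relation.Binary.Core using (Rel)
open import Relation.Binary.Definitions using (DecidableEquality)
open import Relation.Binary.PropositionalEquality.Core using (_≡_; _≢_)
open import Relation.Binary.Structures using (IsStrictPartialOrder)
open import Relation.Nullary.Construct.Add.Supremum using (_⁺; [_]; ⊤⁺)
open import Relation.Nullary.Decidable.Core using (Dec; does; ¬?; _×-dec_; _⊎-dec_)
open import Relation.Nullary.Negation.Core using (¬_)
open import Relation.Unary using (Pred; Decidable)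

-- The real numbers, as a Cauchy complete Archimedean ordered field.  Classically
-- this determines the field up to isomorphism.  "Distinct" is the apartness _#_,
-- which classically is the negation of _≈_; the Cauchy reals are a constructive
-- model of these axioms.

record RealNumbers c ℓ₁ ℓ₂ ℓ₃ : Set (lsuc (c ⊔ ℓ₁ ⊔ ℓ₂ ⊔ ℓ₃)) where
  infix 4 _<_
  field
    heytingField : HeytingField c ℓ₁ ℓ₂

  open HeytingField heytingField public

  commutativeRing : CommutativeRing c ℓ₁
  commutativeRing = record { isCommutativeRing = isCommutativeRing }

  open CommutativeRing commutativeRing public
    using (+-rawMonoid; *-rawMonoid)

  field
    _<_                  : Rel Carrier ℓ₃
    isStrictPartialOrder : IsStrictPartialOrder _≈_ _<_
    #⇔<⊎>                : ∀ {x y} → x # y ⇔ (x < y ⊎ y < x)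
    +-monoˡ-<            : ∀ {x y} z → x < y → x + z < y + z
    *-positive           : ∀ {x y} → 0# < x → 0# < y → 0# < x * y

  _within_of_ : Carrier → Carrier → Carrier → Set ℓ₃
  x within ε of y = (x < y + ε) × (y < x + ε)

  IsCauchy : (ℕ → Carrier) → Set (c ⊔ ℓ₃)
  IsCauchy s = ∀ ε → 0# < ε →
    ∃[ N ] ∀ m n → N ≤ m → N ≤ n → s m within ε of s n

  _ConvergesTo_ : (ℕ → Carrier) → Carrier → Set (c ⊔ ℓ₃)
  s ConvergesTo x = ∀ ε → 0# < ε →
    ∃[ N ] ∀ n → N ≤ n → s n within ε of x

  field
    archimedean : ∀ x → ∃[ n ] x < RawMonoidDefs._×_ +-rawMonoid n 1#
    complete    : ∀ s → IsCauchy s → ∃[ x ] s ConvergesTo x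


countFin : ∀ {n p} {P : Pred (Fin n) p} → Decidable P → ℕ
countFin P? = length (filter P? (allFin _))


-- Vertices and edges are numbered; the order in which the two ends of an edge
-- are listed carries no meaning.

record Graph : Set where
  field
    order size : ℕ

  V : Set
  V = Fin order

  E : Set
  E = Fin size

  field
    end₁ end₂ : E → V

  Joins : E → V → V → Set
  Joins e u v = (end₁ e ≡ u × end₂ e ≡ v) ⊎ (end₁ e ≡ v × end₂ e ≡ u)

  field
    loopless   : ∀ e → end₁ e ≢ end₂ e
    noParallel : ∀ {e e′ u v} → Joins e u v → Joins e′ u v → e ≡ e′

  Adjacent : Rel V 0ℓ
  Adjacent u v = ∃[ e ] Joins e u v

  Incident : V → E → Set
  Incident v e = v ≡ end₁ e ⊎ v ≡ end₂ e

  incident? : ∀ v e → Dec (Incident v e)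
  incident? v e = (v ≟ end₁ e) ⊎-dec (v ≟ end₂ e)

  _≟ⱽᴱ_ : DecidableEquality (V ⊎ E)
  _≟ⱽᴱ_ = ≡-dec _≟_ _≟_


record Orientation (G : Graph) : Set where
  open Graph G
  field
    tail head : E → V
    joins     : ∀ e → Joins e (tail e) (head e)

  Arc : Rel V 0ℓ
  Arc u v = ∃[ e ] (tail e ≡ u × head e ≡ v)

  outDegree : V → ℕ
  outDegree v = countFin (λ e → tail e ≟ v)

  Acyclic : Set
  Acyclic = ∀ v → ¬ TransClosure Arc v v


record IsTwoTree (G : Graph) : Set where
  open Graph G
  field
    orientation : Orientation G

  open Orientation orientation

  field
    acyclic     : Acyclic
    v₀ v₁       : V
    v₀v₁        : Adjacent v₀ v₁
    outDegree₀  : outDegree v₀ ≡ 0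
    outDegree₁  : outDegree v₁ ≡ 1
    outDegree₂  : ∀ v → v ≢ v₀ → v ≢ v₁ → outDegree v ≡ 2
    outAdjacent : ∀ v → v ≢ v₀ → v ≢ v₁ →
                  ∀ {x y} → Arc v x → Arc v y → x ≢ y → Adjacent x y


-- By insert-remove, every permutation occurs exactly once up to pointwise equality.

permutations : ∀ n → List (Permutation′ n)
permutations zero    = id ∷ []
permutations (suc n) =
  concatMap (λ j → map (insert zero j) (permutations n)) (allFin (suc n))


module _ {c ℓ₁ ℓ₂ ℓ₃} (ℝ : RealNumbers c ℓ₁ ℓ₂ ℓ₃) where
  open RealNumbers ℝ

  sumOver : ∀ {a} {A : Set a} → List A → (A → Carrier) → Carrier
  sumOver xs f = foldr _+_ 0# (map f xs)

  product : ∀ {n} → (Fin n → Carrier) → Carrier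
  product = RawMonoidDefs.sum *-rawMonoid

  permanent : ∀ {m} → (Fin m → Fin m → Carrier) → Carrier
  permanent {m} A = sumOver (permutations m) λ σ → product λ i → A i (σ ⟨$⟩ʳ i)

  module _ {C : Set} (_≟ᶜ_ : DecidableEquality C) {m} (A : Fin m → C → Carrier) where

    -- κ j is the index of the column of A used as the j-th column of A′.
    NonzeroPermanent≤ : ℕ → Set ℓ₂
    NonzeroPermanent≤ k = Σ (Fin m → C) λ κ →
      permanent (λ i j → A i (κ j)) # 0# ×
      (∀ z → countFin (λ j → κ j ≟ᶜ z) ≤ k)

    -- The graph of pind, with ⊤⁺ for ∞.
    PermanentIndex : ℕ ⁺ → Set ℓ₂
    PermanentIndex [ k ] = NonzeroPermanent≤ k × (∀ j → NonzeroPermanent≤ j → k ≤ j)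
    PermanentIndex ⊤⁺    = ∀ k → ¬ NonzeroPermanent≤ k

  module _ (G : Graph) where
    open Graph G

    edgeMatrix : Orientation G → E → V ⊎ E → Carrier
    edgeMatrix o e z =
      if does (on? z head) then 1# else if does (on? z tail) then - 1# else 0#
      where
      open Orientation o

      On : V ⊎ E → (E → V) → Set
      On (inj₁ v) end = v ≡ end e
      On (inj₂ f) end = f ≢ e × Incident (end e) f

      on? : ∀ z end → Dec (On z end)
      on? (inj₁ v) end = v ≟ end e
      on? (inj₂ f) end = ¬? (f ≟ e) ×-dec incident? (end e) f

    Weighting : Set c
    Weighting = V ⊎ E → Carrier

    vertexSum : Weighting → V → Carrier
    vertexSum f v =
      f (inj₁ v) + sumOver (filter (incident? v) (allFin size)) λ e → f (inj₂ e)

    Proper : Weighting → Set ℓ₂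
    Proper f = ∀ {u v} → Adjacent u v → vertexSum f u # vertexSum f v

    record RealSet (k : ℕ) : Set (c ⊔ ℓ₂) where
      field
        element  : Fin k → Carrier
        distinct : ∀ {i j} → i ≢ j → element i # element j

    _∈_ : ∀ {k} → Carrier → RealSet k → Set ℓ₁
    x ∈ S = ∃[ i ] x ≈ RealSet.element S i

    Choosable : ℕ → ℕ → Set (c ⊔ ℓ₁ ⊔ ℓ₂)
    Choosable k k′ =
      (Lⱽ : V → RealSet k) (Lᴱ : E → RealSet k′) →
      Σ Weighting λ f →
        (∀ v → f (inj₁ v) ∈ Lⱽ v) × (∀ e → f (inj₂ e) ∈ Lᴱ e) × Proper f

module Submission where

-- Every column of A_G has the form φ (head e) − φ (tail e) for a potential φ on V: φ is the
-- indicator of v for a vertex v, and the indicator of {u, v} for an edge uv.  Vertices are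
-- removed in small blocks X such that no remaining edge enters X.  If the columns used for X have
-- potentials supported on X, the matrix is block triangular and only the permanent of the block
-- matters.  An edge leaving X has a potential with an end outside X, but if the edges e and f
-- have the same head then the difference of their columns is supported on X; expanding the
-- permanent in such a column, one of the two edges can be chosen at the end.  With leaves taken to
-- be the vertices without in-neighbours, and x → p, x → q, the blocks are
--   {v, w}     two leaves v, w over an edge ab: v, w, va − wa, vb − wb;
--   {v, x}     v is the only leaf over xp:      v, x, vx, vp − xp  (without vx if x is v₁);
--   {w, v, x}  v is over xp and w is over xq:   w, v, x, wx, vx, vp − xp;
--   {v₁}                                        v₁.
-- Acyclicity provides a vertex x whose in-neighbours are all leaves.  For such x each leaf above x
-- lies over xp or xq, so one of the blocks occurs.
--
-- For choosability, the alternating sum of ∏ₑ (φ(head e) − φ(tail e)), φ being the vertex sums,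
-- over the two choices of each weight used as a column is the permanent times the product of the
-- differences of the two weights, as in Ryser's formula.  Hence some choice is proper.

open import Defs hiding (_∈_)
open import Algebra.Apartness.Properties.HeytingCommutativeRing as HeytingProperties using ()
open import Algebra.Bundles using (CommutativeRing)
import Algebra.Properties.CommutativeSemigroup as CommutativeSemigroupProperties
import Algebra.Properties.Ring as RingProperties
import Algebra.Properties.Semiring.Mult as Multiples
open import Data.Bool.Base using (if_then_else_; true; false)
open import Data.Fin.Base using (Fin; zero; suc; punchIn)
open import Data.Fin.Induction using (spo-wellFounded)
open import Data.Fin.Patterns using (0F; 1F; 2F)
open import Data.Fin.Permutation using (Permutation′; _⟨$⟩ʳ_; insert)
open import Data.Fin.Properties using (_≟_; any?)
open import Data.Integer.Base as ℤ using (ℤ; 0ℤ; 1ℤ; -1ℤ; +_; -[1+_])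
import Data.Integer.Properties as ℤ
open import Data.Integer.Solver using (module +-*-Solver)
open import Data.List.Base using (List; []; _∷_; _++_; length; map; filter; foldr; concatMap; allFin; lookup; tabulate)
open import Data.List.Properties using (map-∘; length-map; length-++; length-tabulate; filter-notAll;
  filter-some; map-tabulate; tabulate-lookup; ++-assoc)
import Data.List.Membership.DecPropositional as DecMembership
open import Data.List.Membership.Propositional using (_∈_; _∉_; find; lose)
open import Data.List.Membership.Propositional.Properties
open import Data.List.Membership.Propositional.Properties.WithK using (unique∧set⇒bag)
open import Data.List.Relation.Binary.BagAndSetEquality using (∼bag⇒↭)
open import Data.List.Relation.Binary.Disjoint.Propositional using (Disjoint)
open import Data.List.Relation.Binary.Permutation.Propositional as ↭ using (_↭_; ↭-sym; ↭⇒↭ₛ)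
open import Data.List.Relation.Binary.Permutation.Propositional.Properties using (∈-resp-↭; ↭-length; ++⁺; shift)
open import Data.List.Relation.Binary.Permutation.Setoid.Properties using (Unique-resp-↭)
open import Data.List.Relation.Binary.Pointwise as Pointwise using (Pointwise; []; _∷_)
open import Data.List.Relation.Binary.Sublist.Propositional using (_⊆_; []; _∷_; _∷ʳ_)
open import Data.List.Relation.Binary.Sublist.Propositional.Properties using (All-resp-⊆)
open import Data.List.Relation.Unary.All as All using ([]; _∷_)
import Data.List.Relation.Unary.All.Properties as All
open import Data.List.Relation.Unary.AllPairs as AllPairs using ([]; _∷_)
import Data.List.Relation.Unary.AllPairs.Properties as AllPairs
open import Data.List.Relation.Unary.Any using (here; there)
open import Data.List.Relation.Unary.Unique.Propositional using (Unique)
import Data.List.Relation.Unary.Unique.Propositional.Properties as Unique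
open import Data.Maybe.Base using (Maybe; just; nothing; maybe)
open import Data.Nat.Base as ℕ using (ℕ; suc; z≤n; s≤s)
import Data.Nat.Properties as ℕ
open import Data.Product.Base using (Σ; ∃; ∃₂; _×_; _,_; proj₁; proj₂)
open import Data.Sum.Base as Sum using (_⊎_; inj₁; inj₂; [_,_]′)
open import Data.Sum.Properties using (inj₁-injective; inj₂-injective)
open import Function.Base using (_∘_; id)
open import Function.Bundles using (mk⇔; Equivalence)
open import Induction.WellFounded using (Acc; acc; WellFounded)
open import Level using (Level)
open import Relation.Binary.Construct.Closure.Transitive as Plus using (TransClosure)
open import Relation.Binary.PropositionalEquality as ≡ using (_≡_; _≢_; refl; sym; trans; cong; cong₂; subst;
  subst₂; resp₂; module ≡-Reasoning)
import Relation.Binary.Reasoning.Setoid as SetoidReasoning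
open import Relation.Binary.Structures using (IsStrictPartialOrder)
open import Relation.Nullary.Construct.Add.Supremum using ([_])
open import Relation.Nullary.Decidable using (Dec; yes; no; does; does-⇔; ¬?; _×-dec_)
open import Relation.Nullary.Negation using (¬_; contradiction)

-- Permanents of matrices indexed by lists, over a commutative ring.

module Permanents {c ℓ} (R : CommutativeRing c ℓ) where
  open CommutativeRing R renaming (refl to ≈-refl; sym to ≈-sym; trans to ≈-trans)
  open RingProperties ring using (-‿distribʳ-*; -0#≈0#; -‿+-comm)
  open CommutativeSemigroupProperties +-commutativeSemigroup
    using () renaming (interchange to +-medial; x∙yz≈y∙xz to +-swapˡ; xy∙z≈xz∙y to +-swapʳ)
  open CommutativeSemigroupProperties *-commutativeSemigroup
    using () renaming (x∙yz≈y∙xz to *-swapˡ; interchange to *-medial)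
  open SetoidReasoning setoid

  private
    variable
      a b a′ b′ r : Level
      A : Set a
      B : Set b
      A′ : Set a′
      B′ : Set b′

  -- Each element is passed to `g` together with the list of the others in their original order, so
  -- that expansion of a permanent needs no index arithmetic.
  sumPicks : List A → (A → List A → Carrier) → Carrier
  sumPicks []       g = 0#
  sumPicks (x ∷ xs) g = g x xs + sumPicks xs λ y ys → g y (x ∷ ys)

  -- Expansion along the first row. Lists in place of `Fin n` make it easy to split, permute and
  -- relabel rows and columns; if the two lengths differ the value is 0.
  per : (A → B → Carrier) → List A → List B → Carrier
  per M []       []      = 1#
  per M []       (_ ∷ _) = 0#
  per M (x ∷ xs) ys      = sumPicks ys λ y zs → M x y * per M xs zs

  -- The hypothesis is asked for actual picks only. The permutation that it receives gives the
  -- length of `ys`, which inductions on minors need.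
  sumPicks-cong-↭ : ∀ (xs : List A) {g h} → (∀ {y ys} → y ∷ ys ↭ xs → g y ys ≈ h y ys) →
                    sumPicks xs g ≈ sumPicks xs h
  sumPicks-cong-↭ []       g≈h = ≈-refl
  sumPicks-cong-↭ (x ∷ xs) g≈h = +-cong (g≈h ↭.refl)
    (sumPicks-cong-↭ xs λ {y} p → g≈h (↭.trans (↭.swap y x ↭.refl) (↭.prep x p)))

  sumPicks-cong : ∀ (xs : List A) {g h} → (∀ y ys → g y ys ≈ h y ys) →
                  sumPicks xs g ≈ sumPicks xs h
  sumPicks-cong xs g≈h = sumPicks-cong-↭ xs λ _ → g≈h _ _

  sumPicks-+ : ∀ (xs : List A) g h →
               sumPicks xs (λ y ys → g y ys + h y ys) ≈ sumPicks xs g + sumPicks xs h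
  sumPicks-+ []       g h = ≈-sym (+-identityˡ 0#)
  sumPicks-+ (x ∷ xs) g h = ≈-trans (+-congˡ (sumPicks-+ xs _ _)) (+-medial _ _ _ _)

  sumPicks-*ˡ : ∀ k (xs : List A) g → k * sumPicks xs g ≈ sumPicks xs λ y ys → k * g y ys
  sumPicks-*ˡ k []       g = zeroʳ k
  sumPicks-*ˡ k (x ∷ xs) g = ≈-trans (distribˡ k _ _) (+-congˡ (sumPicks-*ˡ k xs _))

  sumPicks-*ʳ : ∀ (xs : List A) g k → sumPicks xs g * k ≈ sumPicks xs λ y ys → g y ys * k
  sumPicks-*ʳ xs g k = begin
    sumPicks xs g * k                 ≈⟨ *-comm _ k ⟩
    k * sumPicks xs g                 ≈⟨ sumPicks-*ˡ k xs g ⟩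
    sumPicks xs (λ y ys → k * g y ys) ≈⟨ sumPicks-cong xs (λ _ _ → *-comm k _) ⟩
    sumPicks xs (λ y ys → g y ys * k) ∎

  sumPicks-0 : ∀ (xs : List A) {g} → (∀ {y ys} → y ∷ ys ↭ xs → g y ys ≈ 0#) → sumPicks xs g ≈ 0#
  sumPicks-0 []       g≈0 = ≈-refl
  sumPicks-0 (x ∷ xs) g≈0 = ≈-trans
    (+-cong (g≈0 ↭.refl) (sumPicks-0 xs λ {y} p → g≈0 (↭.trans (↭.swap y x ↭.refl) (↭.prep x p))))
    (+-identityˡ 0#)

  sumPicks-exchange : ∀ (xs : List A) (ys : List B) (g : A → List A → B → List B → Carrier) →
    sumPicks xs (λ x xs′ → sumPicks ys λ y ys′ → g x xs′ y ys′) ≈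
    sumPicks ys (λ y ys′ → sumPicks xs λ x xs′ → g x xs′ y ys′)
  sumPicks-exchange []       ys g = ≈-sym (sumPicks-0 ys λ _ → ≈-refl)
  sumPicks-exchange (x ∷ xs) ys g =
    ≈-trans (+-congˡ (sumPicks-exchange xs ys λ z zs → g z (x ∷ zs))) (≈-sym (sumPicks-+ ys _ _))

  sumPicks-++ : ∀ (xs xs′ : List A) {g} → (∀ {y} ys → y ∈ xs′ → g y ys ≈ 0#) →
                sumPicks (xs ++ xs′) g ≈ sumPicks xs λ y ys → g y (ys ++ xs′)
  sumPicks-++ []       xs′ g≈0 = sumPicks-0 xs′ λ p → g≈0 _ (∈-resp-↭ p (here refl))
  sumPicks-++ (x ∷ xs) xs′ g≈0 = +-congˡ (sumPicks-++ xs xs′ λ ys → g≈0 (x ∷ ys))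

  sumPicks-pointwise : {_∼_ : A → A′ → Set r} → ∀ {xs xs′ g g′} → Pointwise _∼_ xs xs′ →
    (∀ {y y′ ys ys′} → y ∼ y′ → Pointwise _∼_ ys ys′ → g y ys ≈ g′ y′ ys′) →
    sumPicks xs g ≈ sumPicks xs′ g′
  sumPicks-pointwise []        g≈g′ = ≈-refl
  sumPicks-pointwise (x∼x′ ∷ p) g≈g′ =
    +-cong (g≈g′ x∼x′ p) (sumPicks-pointwise p λ y∼y′ q → g≈g′ y∼y′ (x∼x′ ∷ q))

  -- The two matrices may have different index types. This is what allows a block of the graph's
  -- matrix to be replaced by a small closed matrix.
  per-pointwise : ∀ {r₁ r₂} {_∼₁_ : A → A′ → Set r₁} {_∼₂_ : B → B′ → Set r₂} {M M′} →
    (∀ {x x′ y y′} → x ∼₁ x′ → y ∼₂ y′ → M x y ≈ M′ x′ y′) →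
    ∀ {xs xs′ ys ys′} → Pointwise _∼₁_ xs xs′ → Pointwise _∼₂_ ys ys′ →
    per M xs ys ≈ per M′ xs′ ys′
  per-pointwise M≈M′ []       []      = ≈-refl
  per-pointwise M≈M′ []       (_ ∷ _) = ≈-refl
  per-pointwise M≈M′ (p ∷ ps) qs      = sumPicks-pointwise qs λ y∼y′ qs′ →
    *-cong (M≈M′ p y∼y′) (per-pointwise M≈M′ ps qs′)

  module _ (M : A → B → Carrier) where

    -- After expansion along the first row, each minor is expanded along its column `y` by
    -- induction, and the two sums are exchanged.
    per-expandColumn : ∀ xs y ys → per M xs (y ∷ ys) ≈ sumPicks xs λ x xs′ → M x y * per M xs′ ys
    per-expandColumn []       y ys = ≈-refl
    per-expandColumn (x ∷ xs) y ys = +-congˡ (begin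
      sumPicks ys (λ z zs → M x z * per M xs (y ∷ zs))
        ≈⟨ sumPicks-cong ys (λ z zs → ≈-trans (*-congˡ (per-expandColumn xs y zs)) (sumPicks-*ˡ _ xs _)) ⟩
      sumPicks ys (λ z zs → sumPicks xs λ x′ xs′ → M x z * (M x′ y * per M xs′ zs))
        ≈⟨ sumPicks-exchange ys xs (λ z zs x′ xs′ → M x z * (M x′ y * per M xs′ zs)) ⟩
      sumPicks xs (λ x′ xs′ → sumPicks ys λ z zs → M x z * (M x′ y * per M xs′ zs))
        ≈⟨ sumPicks-cong xs (λ x′ xs′ → ≈-trans (sumPicks-cong ys λ z zs → *-swapˡ _ _ _)
             (≈-sym (sumPicks-*ˡ _ ys _))) ⟩
      sumPicks xs (λ x′ xs′ → M x′ y * per M (x ∷ xs′) ys) ∎)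

    -- In the expansion along the first column, the terms of the two rows change places and the
    -- others agree by induction on the columns.
    per-swapRows : ∀ x x′ xs ys → per M (x ∷ x′ ∷ xs) ys ≈ per M (x′ ∷ x ∷ xs) ys
    per-swapRows x x′ xs []       = ≈-refl
    per-swapRows x x′ xs (y ∷ ys) = begin
      per M (x ∷ x′ ∷ xs) (y ∷ ys)
        ≈⟨ per-expandColumn (x ∷ x′ ∷ xs) y ys ⟩
      M x y * per M (x′ ∷ xs) ys + (M x′ y * per M (x ∷ xs) ys +
        sumPicks xs λ z zs → M z y * per M (x ∷ x′ ∷ zs) ys)
        ≈⟨ +-swapˡ _ _ _ ⟩
      M x′ y * per M (x ∷ xs) ys + (M x y * per M (x′ ∷ xs) ys +
        sumPicks xs λ z zs → M z y * per M (x ∷ x′ ∷ zs) ys)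
        ≈⟨ +-congˡ (+-congˡ (sumPicks-cong xs λ z zs → *-congˡ (per-swapRows x x′ zs ys))) ⟩
      M x′ y * per M (x ∷ xs) ys + (M x y * per M (x′ ∷ xs) ys +
        sumPicks xs λ z zs → M z y * per M (x′ ∷ x ∷ zs) ys)
        ≈⟨ per-expandColumn (x′ ∷ x ∷ xs) y ys ⟨
      per M (x′ ∷ x ∷ xs) (y ∷ ys) ∎

    per-↭ : ∀ {xs xs′} → xs ↭ xs′ → ∀ ys → per M xs ys ≈ per M xs′ ys
    per-↭ ↭.refl          ys = ≈-refl
    per-↭ (↭.prep {xs} x p) ys = sumPicks-cong ys λ _ zs → *-congˡ (per-↭ {xs} p zs)
    per-↭ (↭.swap {xs} x x′ p) ys = ≈-trans (per-swapRows x x′ xs ys)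
      (sumPicks-cong ys λ _ zs → *-congˡ (sumPicks-cong zs λ _ ws → *-congˡ (per-↭ {xs} p ws)))
    per-↭ (↭.trans p q)   ys = ≈-trans (per-↭ p ys) (per-↭ q ys)

    -- Expansion along the first column of `ys`: rows of `xs′` contribute 0, and the minors left are
    -- again block triangular with one column fewer.
    per-block : ∀ xs xs′ ys ys′ → length xs ≡ length ys →
                (∀ {x y} → x ∈ xs′ → y ∈ ys → M x y ≈ 0#) →
                per M (xs ++ xs′) (ys ++ ys′) ≈ per M xs ys * per M xs′ ys′
    per-block []      xs′ []       ys′ _ _   = ≈-sym (*-identityˡ _)
    per-block []      xs′ (y ∷ ys) ys′ () _
    per-block (x ∷ xs) xs′ []       ys′ () _
    per-block xs@(_ ∷ _) xs′ (y ∷ ys) ys′ len M≈0 = begin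
      per M (xs ++ xs′) (y ∷ ys ++ ys′)
        ≈⟨ per-expandColumn (xs ++ xs′) y _ ⟩
      sumPicks (xs ++ xs′) (λ z zs → M z y * per M zs (ys ++ ys′))
        ≈⟨ sumPicks-++ xs xs′ (λ zs z∈ → ≈-trans
             (*-congʳ {per M zs (ys ++ ys′)} (M≈0 z∈ (here refl))) (zeroˡ _)) ⟩
      sumPicks xs (λ z zs → M z y * per M (zs ++ xs′) (ys ++ ys′))
        ≈⟨ sumPicks-cong-↭ xs (λ {_} {zs} p → ≈-trans
             (*-congˡ (per-block zs xs′ ys ys′ (ℕ.suc-injective (trans (↭-length p) len)) (λ x∈ y∈ → M≈0 x∈ (there y∈))))
             (≈-sym (*-assoc _ _ _))) ⟩
      sumPicks xs (λ z zs → M z y * per M zs ys * per M xs′ ys′)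
        ≈⟨ sumPicks-*ʳ xs (λ z zs → M z y * per M zs ys) _ ⟨
      sumPicks xs (λ z zs → M z y * per M zs ys) * per M xs′ ys′
        ≈⟨ *-congʳ (per-expandColumn xs y ys) ⟨
      per M xs (y ∷ ys) * per M xs′ ys′ ∎

    -- Expansion along the columns `zs` reduces the claim to the first column, where it is
    -- distributivity.
    per-column-+ : ∀ {y y₁ y₂} → (∀ x → M x y ≈ M x y₁ + M x y₂) → ∀ xs zs ys →
      per M xs (zs ++ y ∷ ys) ≈ per M xs (zs ++ y₁ ∷ ys) + per M xs (zs ++ y₂ ∷ ys)
    per-column-+ {y} {y₁} {y₂} M≈+ xs [] ys = begin
      per M xs (y ∷ ys)
        ≈⟨ per-expandColumn xs y ys ⟩
      sumPicks xs (λ x xs′ → M x y * per M xs′ ys)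
        ≈⟨ sumPicks-cong xs (λ x xs′ → ≈-trans (*-congʳ (M≈+ x)) (distribʳ _ _ _)) ⟩
      sumPicks xs (λ x xs′ → M x y₁ * per M xs′ ys + M x y₂ * per M xs′ ys)
        ≈⟨ sumPicks-+ xs _ _ ⟩
      sumPicks xs (λ x xs′ → M x y₁ * per M xs′ ys) + sumPicks xs (λ x xs′ → M x y₂ * per M xs′ ys)
        ≈⟨ +-cong (per-expandColumn xs y₁ ys) (per-expandColumn xs y₂ ys) ⟨
      per M xs (y₁ ∷ ys) + per M xs (y₂ ∷ ys) ∎
    per-column-+ {y} {y₁} {y₂} M≈+ xs (z ∷ zs) ys = begin
      per M xs (z ∷ zs ++ y ∷ ys)
        ≈⟨ per-expandColumn xs z _ ⟩
      sumPicks xs (λ x xs′ → M x z * per M xs′ (zs ++ y ∷ ys))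
        ≈⟨ sumPicks-cong xs (λ x xs′ → ≈-trans (*-congˡ (per-column-+ M≈+ xs′ zs ys)) (distribˡ _ _ _)) ⟩
      sumPicks xs (λ x xs′ → M x z * per M xs′ (zs ++ y₁ ∷ ys) + M x z * per M xs′ (zs ++ y₂ ∷ ys))
        ≈⟨ sumPicks-+ xs (λ x xs′ → M x z * per M xs′ (zs ++ y₁ ∷ ys))
                         (λ x xs′ → M x z * per M xs′ (zs ++ y₂ ∷ ys)) ⟩
      sumPicks xs (λ x xs′ → M x z * per M xs′ (zs ++ y₁ ∷ ys)) +
      sumPicks xs (λ x xs′ → M x z * per M xs′ (zs ++ y₂ ∷ ys))
        ≈⟨ +-cong (per-expandColumn xs z (zs ++ y₁ ∷ ys)) (per-expandColumn xs z (zs ++ y₂ ∷ ys)) ⟨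
      per M xs (z ∷ zs ++ y₁ ∷ ys) + per M xs (z ∷ zs ++ y₂ ∷ ys) ∎

  -- Scaling of rows and columns, and Ryser's formula.

  listProduct : (A → Carrier) → List A → Carrier
  listProduct f []       = 1#
  listProduct f (x ∷ xs) = f x * listProduct f xs

  listProduct-cong : ∀ (xs : List A) {c c′} → (∀ {x} → x ∈ xs → c x ≈ c′ x) → listProduct c xs ≈ listProduct c′ xs
  listProduct-cong []       c≈c′ = ≈-refl
  listProduct-cong (x ∷ xs) c≈c′ = *-cong (c≈c′ (here refl)) (listProduct-cong xs (c≈c′ ∘ there))

  module _ (M : A → B → Carrier) where

    -- In contrapositive form, a nonzero permanent forces as many columns as rows.
    per-length : ∀ xs ys → length xs ≢ length ys → per M xs ys ≈ 0#
    per-length []       []       ≢ = contradiction refl ≢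
    per-length []       (_ ∷ _)  ≢ = ≈-refl
    per-length (x ∷ xs) ys       ≢ = sumPicks-0 ys λ {y} {zs} p →
      ≈-trans (*-congˡ (per-length xs zs λ eq → ≢ (trans (cong suc eq) (↭-length p)))) (zeroʳ (M x y))

    per-scaleRows : ∀ s xs ys → per (λ x y → s x * M x y) xs ys ≈ listProduct s xs * per M xs ys
    per-scaleRows s []       []      = ≈-sym (*-identityˡ 1#)
    per-scaleRows s []       (_ ∷ _) = ≈-sym (zeroʳ 1#)
    per-scaleRows s (x ∷ xs) ys      = ≈-trans
      (sumPicks-cong ys λ y zs → ≈-trans (*-congˡ (per-scaleRows s xs zs)) (*-medial _ _ _ _))
      (≈-sym (sumPicks-*ˡ _ ys _))

    per-scaleColumns : ∀ d xs ys → per (λ x y → M x y * d y) xs ys ≈ per M xs ys * listProduct d ys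
    per-scaleColumns d []         []       = ≈-sym (*-identityˡ 1#)
    per-scaleColumns d (_ ∷ _)    []       = ≈-sym (zeroˡ 1#)
    per-scaleColumns d xs         (y ∷ ys) = begin
      per (λ x y → M x y * d y) xs (y ∷ ys)
        ≈⟨ per-expandColumn _ xs y ys ⟩
      sumPicks xs (λ x xs′ → M x y * d y * per (λ x y → M x y * d y) xs′ ys)
        ≈⟨ sumPicks-cong xs (λ x xs′ → ≈-trans (*-congˡ (per-scaleColumns d xs′ ys)) (*-medial _ _ _ _)) ⟩
      sumPicks xs (λ x xs′ → M x y * per M xs′ ys * (d y * listProduct d ys))
        ≈⟨ sumPicks-*ʳ xs (λ x xs′ → M x y * per M xs′ ys) _ ⟨
      sumPicks xs (λ x xs′ → M x y * per M xs′ ys) * (d y * listProduct d ys)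
        ≈⟨ *-congʳ (per-expandColumn M xs y ys) ⟨
      per M xs (y ∷ ys) * (d y * listProduct d ys) ∎

    shifted : (A → Carrier) → B → A → Carrier
    shifted c y x = c x + M x y

    -- The alternating sum over all T ⊆ ys of the products of c x + Σ_{y ∈ T} M x y over x ∈ xs.
    alternating : List A → (A → Carrier) → List B → Carrier
    alternating xs c []       = listProduct c xs
    alternating xs c (y ∷ ys) = alternating xs (shifted c y) ys - alternating xs c ys

    alternating-cong : ∀ xs {c c′} ys → (∀ {x} → x ∈ xs → c x ≈ c′ x) →
                       alternating xs c ys ≈ alternating xs c′ ys
    alternating-cong xs []       c≈c′ = listProduct-cong xs c≈c′
    alternating-cong xs (y ∷ ys) c≈c′ = +-cong
      (alternating-cong xs ys λ x∈ → +-congʳ (c≈c′ x∈)) (-‿cong (alternating-cong xs ys c≈c′))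

    sumPicks-neg : ∀ ys (g : B → List B → Carrier) → - sumPicks ys g ≈ sumPicks ys λ y zs → - g y zs
    sumPicks-neg []       g = -0#≈0#
    sumPicks-neg (y ∷ ys) g = ≈-trans (≈-sym (-‿+-comm _ _)) (+-congˡ (sumPicks-neg ys _))

    -- Only the factor of `x` is multiplied out. Its summand `c x` is common to all subsets; its
    -- summand `M x y` occurs for the subsets containing `y`, and these correspond to the subsets of
    -- the other columns with the shift by `y` built in.
    alternating-expandRow : ∀ x xs c ys → alternating (x ∷ xs) c ys ≈
      c x * alternating xs c ys + sumPicks ys λ y zs → M x y * alternating xs (shifted c y) zs
    alternating-expandRow x xs c []       = ≈-sym (+-identityʳ _)
    alternating-expandRow x xs c (y ∷ ys) = begin
      alternating (x ∷ xs) (shifted c y) ys - alternating (x ∷ xs) c ys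
        ≈⟨ +-cong (alternating-expandRow x xs (shifted c y) ys) (-‿cong (alternating-expandRow x xs c ys)) ⟩
      ((c x + M x y) * P + Σ₁) - (c x * Q + Σ₂)
        ≈⟨ +-cong (+-congʳ (distribʳ P (c x) (M x y))) (≈-sym (-‿+-comm _ _)) ⟩
      ((c x * P + M x y * P) + Σ₁) + (- (c x * Q) - Σ₂)
        ≈⟨ +-congʳ (+-assoc _ _ _) ⟩
      (c x * P + (M x y * P + Σ₁)) + (- (c x * Q) - Σ₂)
        ≈⟨ +-medial _ _ _ _ ⟩
      (c x * P - c x * Q) + ((M x y * P + Σ₁) - Σ₂)
        ≈⟨ +-cong (≈-trans (+-congˡ (-‿distribʳ-* (c x) Q)) (≈-sym (distribˡ (c x) P (- Q)))) (+-assoc _ _ _) ⟩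
      c x * (P - Q) + (M x y * P + (Σ₁ - Σ₂))
        ≈⟨ +-congˡ (+-congˡ difference) ⟩
      c x * (P - Q) + (M x y * P + sumPicks ys λ z zs → M x z * alternating xs (shifted c z) (y ∷ zs)) ∎
      where
      P = alternating xs (shifted c y) ys
      Q = alternating xs c ys
      Σ₁ = sumPicks ys λ z zs → M x z * alternating xs (shifted (shifted c y) z) zs
      Σ₂ = sumPicks ys λ z zs → M x z * alternating xs (shifted c z) zs
      difference : Σ₁ - Σ₂ ≈ sumPicks ys λ z zs → M x z * alternating xs (shifted c z) (y ∷ zs)
      difference = begin
        Σ₁ - Σ₂
          ≈⟨ +-congˡ (sumPicks-neg ys _) ⟩
        Σ₁ + sumPicks ys (λ z zs → - (M x z * alternating xs (shifted c z) zs))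
          ≈⟨ sumPicks-+ ys (λ z zs → M x z * alternating xs (shifted (shifted c y) z) zs) _ ⟨
        sumPicks ys (λ z zs → M x z * alternating xs (shifted (shifted c y) z) zs -
                            M x z * alternating xs (shifted c z) zs)
          -- The shifts by `y` and by `z` commute, so the two terms differ by an alternating sum
          -- over `y ∷ zs`.
          ≈⟨ sumPicks-cong ys (λ z zs → ≈-trans
               (+-cong (*-congˡ (alternating-cong xs zs λ _ → +-swapʳ _ _ _)) (-‿distribʳ-* _ _))
               (≈-sym (distribˡ _ _ _))) ⟩
        sumPicks ys (λ z zs → M x z * alternating xs (shifted c z) (y ∷ zs)) ∎

    -- There are more differences than factors.
    alternating-0 : ∀ xs c ys → length xs ℕ.< length ys → alternating xs c ys ≈ 0#
    alternating-0 []       c (y ∷ ys) _   = ≈-trans (+-congʳ (alternating-cong [] ys λ ())) (-‿inverseʳ _)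
    alternating-0 (x ∷ xs) c ys       lt  = begin
      alternating (x ∷ xs) c ys
        ≈⟨ alternating-expandRow x xs c ys ⟩
      c x * alternating xs c ys + sumPicks ys (λ y zs → M x y * alternating xs (shifted c y) zs)
        ≈⟨ +-cong
             (≈-trans (*-congˡ (alternating-0 xs c ys (ℕ.<-trans (ℕ.n<1+n _) lt))) (zeroʳ _))
             (sumPicks-0 ys λ {y} {zs} p → ≈-trans
               (*-congˡ (alternating-0 xs _ zs (ℕ.≤-pred (subst (suc (suc (length xs)) ℕ.≤_) (sym (↭-length p)) lt))))
               (zeroʳ _)) ⟩
      0# + 0# ≈⟨ +-identityʳ 0# ⟩
      0#      ∎

    -- In the row expansion the term with `c x` has more differences than factors and vanishes. What
    -- remains is the expansion of the permanent along row `x`, so `c` has no influence on the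
    -- value.
    alternating≈per : ∀ xs c ys → length xs ≡ length ys → alternating xs c ys ≈ per M xs ys
    alternating≈per []       c []        _   = ≈-refl
    alternating≈per (x ∷ xs) c ys        len = begin
      alternating (x ∷ xs) c ys
        ≈⟨ alternating-expandRow x xs c ys ⟩
      c x * alternating xs c ys + sumPicks ys (λ y zs → M x y * alternating xs (shifted c y) zs)
        ≈⟨ +-cong
             (≈-trans (*-congˡ (alternating-0 xs c ys (ℕ.≤-reflexive len))) (zeroʳ _))
             (sumPicks-cong-↭ ys λ {y} {zs} p →
               *-congˡ (alternating≈per xs _ zs (ℕ.suc-injective (trans len (sym (↭-length p)))))) ⟩
      0# + per M (x ∷ xs) ys ≈⟨ +-identityˡ _ ⟩
      per M (x ∷ xs) ys      ∎

-- The homomorphism from the integers to a commutative ring.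

module IntegerEmbedding {c ℓ} (R : CommutativeRing c ℓ) where
  open CommutativeRing R renaming (refl to ≈-refl; sym to ≈-sym; trans to ≈-trans)
  open RingProperties ring using (-‿distribˡ-*; -‿distribʳ-*; -0#≈0#; -‿+-comm; -‿involutive)
  open CommutativeSemigroupProperties +-commutativeSemigroup
    using () renaming (interchange to +-medial)
  open Multiples semiring using (×-homo-+; ×1-homo-*) renaming (_×_ to _×ᴺ_)
  open SetoidReasoning setoid
  open Permanents using (sumPicks; per)

  -- Permanents are studied over `ℤ`, where closed terms evaluate and vanishing is decidable, and
  -- are carried to the reals at the end.
  ι : ℤ → Carrier
  ι (+ n)    = n ×ᴺ 1#
  ι -[1+ n ] = - (suc n ×ᴺ 1#)

  ι-0 : ι 0ℤ ≈ 0#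
  ι-0 = ≈-refl

  ι-1 : ι 1ℤ ≈ 1#
  ι-1 = +-identityʳ 1#

  ι-⊖ : ∀ m n → ι (m ℤ.⊖ n) ≈ m ×ᴺ 1# - n ×ᴺ 1#
  ι-⊖ ℕ.zero  ℕ.zero  = ≈-sym (-‿inverseʳ 0#)
  ι-⊖ ℕ.zero  (suc n) = ≈-sym (+-identityˡ _)
  ι-⊖ (suc m) ℕ.zero  = ≈-sym (≈-trans (+-congˡ -0#≈0#) (+-identityʳ _))
  ι-⊖ (suc m) (suc n) = begin
    ι (suc m ℤ.⊖ suc n)                     ≡⟨ cong ι (ℤ.[1+m]⊖[1+n]≡m⊖n m n) ⟩
    ι (m ℤ.⊖ n)                             ≈⟨ ι-⊖ m n ⟩
    m ×ᴺ 1# - n ×ᴺ 1#                       ≈⟨ +-identityˡ _ ⟨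
    0# + (m ×ᴺ 1# - n ×ᴺ 1#)                ≈⟨ +-congʳ (-‿inverseʳ 1#) ⟨
    (1# - 1#) + (m ×ᴺ 1# - n ×ᴺ 1#)         ≈⟨ +-medial _ _ _ _ ⟩
    (1# + m ×ᴺ 1#) + (- 1# - n ×ᴺ 1#)       ≈⟨ +-congˡ (-‿+-comm 1# (n ×ᴺ 1#)) ⟩
    (1# + m ×ᴺ 1#) - (1# + n ×ᴺ 1#)         ∎

  ι-+ : ∀ i j → ι (i ℤ.+ j) ≈ ι i + ι j
  ι-+ (+ m)    (+ n)    = ×-homo-+ 1# m n
  ι-+ (+ m)    -[1+ n ] = ι-⊖ m (suc n)
  ι-+ -[1+ m ] (+ n)    = ≈-trans (ι-⊖ n (suc m)) (+-comm _ _)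
  ι-+ -[1+ m ] -[1+ n ] = begin
    - (suc (suc (m ℕ.+ n)) ×ᴺ 1#)           ≡⟨ cong (λ k → - (suc k ×ᴺ 1#)) (ℕ.+-suc m n) ⟨
    - ((suc m ℕ.+ suc n) ×ᴺ 1#)             ≈⟨ -‿cong (×-homo-+ 1# (suc m) (suc n)) ⟩
    - (suc m ×ᴺ 1# + suc n ×ᴺ 1#)           ≈⟨ -‿+-comm (suc m ×ᴺ 1#) (suc n ×ᴺ 1#) ⟨
    - (suc m ×ᴺ 1#) - suc n ×ᴺ 1#           ∎

  ι-neg : ∀ i → ι (ℤ.- i) ≈ - ι i
  ι-neg (+ ℕ.zero)  = ≈-sym -0#≈0#
  ι-neg (+ suc n)   = ≈-refl
  ι-neg -[1+ n ]    = ≈-sym (-‿involutive _)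

  ι-pos-* : ∀ m j → ι (+ m ℤ.* j) ≈ m ×ᴺ 1# * ι j
  ι-pos-* m (+ n) = begin
    ι (+ m ℤ.* + n)            ≡⟨ cong ι (ℤ.pos-* m n) ⟨
    (m ℕ.* n) ×ᴺ 1#            ≈⟨ ×1-homo-* m n ⟩
    m ×ᴺ 1# * n ×ᴺ 1#          ∎
  ι-pos-* m -[1+ n ] = begin
    ι (+ m ℤ.* -[1+ n ])       ≡⟨ cong ι (ℤ.neg-distribʳ-* (+ m) (+ suc n)) ⟨
    ι (ℤ.- (+ m ℤ.* + suc n))  ≈⟨ ι-neg (+ m ℤ.* + suc n) ⟩
    - ι (+ m ℤ.* + suc n)      ≈⟨ -‿cong (ι-pos-* m (+ suc n)) ⟩
    - (m ×ᴺ 1# * suc n ×ᴺ 1#)  ≈⟨ -‿distribʳ-* _ _ ⟩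
    m ×ᴺ 1# * - (suc n ×ᴺ 1#)  ∎

  ι-* : ∀ i j → ι (i ℤ.* j) ≈ ι i * ι j
  ι-* (+ m)    j = ι-pos-* m j
  ι-* -[1+ m ] j = begin
    ι (-[1+ m ] ℤ.* j)         ≡⟨ cong ι (ℤ.neg-distribˡ-* (+ suc m) j) ⟨
    ι (ℤ.- (+ suc m ℤ.* j))    ≈⟨ ι-neg (+ suc m ℤ.* j) ⟩
    - ι (+ suc m ℤ.* j)        ≈⟨ -‿cong (ι-pos-* (suc m) j) ⟩
    - (suc m ×ᴺ 1# * ι j)      ≈⟨ -‿distribˡ-* _ _ ⟩
    - (suc m ×ᴺ 1#) * ι j      ∎

  ι-sumPicks : ∀ {b} {B : Set b} (ys : List B) {g h} → (∀ y zs → ι (g y zs) ≈ h y zs) →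
               ι (sumPicks ℤ.+-*-commutativeRing ys g) ≈ sumPicks R ys h
  ι-sumPicks []       _   = ι-0
  ι-sumPicks (y ∷ ys) {g} ι-g = ≈-trans (ι-+ (g y ys) _)
    (+-cong (ι-g y ys) (ι-sumPicks ys {λ z zs → g z (y ∷ zs)} λ z zs → ι-g z (y ∷ zs)))

  ι-per : ∀ {a b} {A : Set a} {B : Set b} (M : A → B → ℤ) xs ys →
          ι (per ℤ.+-*-commutativeRing M xs ys) ≈ per R (λ x y → ι (M x y)) xs ys
  ι-per M []       []      = ι-1
  ι-per M []       (_ ∷ _) = ι-0
  ι-per M (x ∷ xs) ys      = ι-sumPicks ys λ y zs → ≈-trans (ι-* (M x y) _) (*-congˡ (ι-per M xs zs))

-- Lists without repetition, and indicators.

lookup-injective : ∀ {a} {A : Set a} {xs : List A} → Unique xs →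
                   ∀ {i j} → lookup xs i ≡ lookup xs j → i ≡ j
lookup-injective (_ ∷ _)   {zero}  {zero}  _  = refl
lookup-injective (x∉ ∷ _)  {zero}  {suc j} eq = contradiction eq (All.lookup x∉ (∈-lookup j))
lookup-injective (x∉ ∷ _)  {suc i} {zero}  eq = contradiction (sym eq) (All.lookup x∉ (∈-lookup i))
lookup-injective (_ ∷ xs!) {suc i} {suc j} eq = cong suc (lookup-injective xs! eq)

Unique-↭ : ∀ {a} {A : Set a} {xs ys : List A} → xs ↭ ys → Unique xs → Unique ys
Unique-↭ p = Unique-resp-↭ (≡.setoid _) (↭⇒↭ₛ p)

unique∧⇔⇒↭ : ∀ {a} {A : Set a} {xs ys : List A} → Unique xs → Unique ys →
             (∀ {x} → x ∈ xs → x ∈ ys) → (∀ {x} → x ∈ ys → x ∈ xs) → xs ↭ ys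
unique∧⇔⇒↭ xs! ys! f g = ∼bag⇒↭ (unique∧set⇒bag xs! ys! (mk⇔ f g))

Unique-⊆ : ∀ {a} {A : Set a} {xs ys : List A} → xs ⊆ ys → Unique ys → Unique xs
Unique-⊆ []         _           = []
Unique-⊆ (y ∷ʳ p)   (_ ∷ ys!)   = Unique-⊆ p ys!
Unique-⊆ (refl ∷ p) (y∉ ∷ ys!)  = All-resp-⊆ p y∉ ∷ Unique-⊆ p ys!

pointwise-map : ∀ {a b} {A : Set a} {B : Set b} (f : A → B) xs →
                Pointwise (λ x y → y ≡ f x) xs (map f xs)
pointwise-map f []       = []
pointwise-map f (x ∷ xs) = refl ∷ pointwise-map f xs

unique⇒tabulate : ∀ {a} {A : Set a} {n} (xs : List A) → length xs ≡ n → Unique xs →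
  ∃ λ (f : Fin n → A) → (∀ {i j} → f i ≡ f j → i ≡ j) × xs ≡ tabulate f
unique⇒tabulate xs refl xs! = lookup xs , lookup-injective xs! , sym (tabulate-lookup xs)

Unique-++⁻ˡ : ∀ {a} {A : Set a} (xs : List A) {ys} → Unique (xs ++ ys) → Unique xs
Unique-++⁻ˡ []       _           = []
Unique-++⁻ˡ (x ∷ xs) (x∉ ∷ xys!) = All.++⁻ˡ xs x∉ ∷ Unique-++⁻ˡ xs xys!

length≤1 : ∀ {a} {A : Set a} {xs : List A} → Unique xs →
           (∀ {x y} → x ∈ xs → y ∈ xs → x ≡ y) → length xs ℕ.≤ 1
length≤1 {xs = []}        _               _     = z≤n
length≤1 {xs = _ ∷ []}    _               _     = s≤s z≤n
length≤1 {xs = _ ∷ _ ∷ _} ((x≢y ∷ _) ∷ _) equal = contradiction (equal (here refl) (there (here refl))) x≢y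

countFin≤1 : ∀ {n p} {P : Fin n → Set p} (P? : ∀ i → Dec (P i)) →
             (∀ {i j} → P i → P j → i ≡ j) → countFin P? ℕ.≤ 1
countFin≤1 P? equal = length≤1 (Unique.filter⁺ P? (Unique.allFin⁺ _))
  λ i∈ j∈ → equal (proj₂ (∈-filter⁻ P? {xs = allFin _} i∈)) (proj₂ (∈-filter⁻ P? {xs = allFin _} j∈))

list₁ : ∀ {a} {A : Set a} (xs : List A) → length xs ≡ 1 → ∃ λ x → xs ≡ x ∷ []
list₁ (x ∷ []) _ = x , refl

list₂ : ∀ {a} {A : Set a} (xs : List A) → length xs ≡ 2 → ∃₂ λ x y → xs ≡ x ∷ y ∷ []
list₂ (x ∷ y ∷ []) _ = x , y , refl

indicator : ∀ {p} {P : Set p} → Dec P → ℤ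
indicator P? = if does P? then 1ℤ else 0ℤ

indicator-cong : ∀ {p q} {P : Set p} {Q : Set q} (P? : Dec P) (Q? : Dec Q) →
                 (P → Q) → (Q → P) → indicator P? ≡ indicator Q?
indicator-cong P? Q? f g = cong (λ b → if b then 1ℤ else 0ℤ) (does-⇔ (mk⇔ f g) P? Q?)

indicator-yes : ∀ {p} {P : Set p} (P? : Dec P) → P → indicator P? ≡ 1ℤ
indicator-yes (yes _) _ = refl
indicator-yes (no ¬p) p = contradiction p ¬p

indicator-no : ∀ {p} {P : Set p} (P? : Dec P) → ¬ P → indicator P? ≡ 0ℤ
indicator-no (yes p) ¬p = contradiction p ¬p
indicator-no (no _)  _  = refl

-- Potentials of the columns.

module Potentials (G : Graph) where
  open Graph G
  open import Data.Integer.Base using (_+_; _-_)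

  -- On the row of an edge from u to v, the column of A_G with index z has the entry
  -- potential z v − potential z u.  For the edge z itself this is 1 − 1 = 0.
  potential : V ⊎ E → V → ℤ
  potential (inj₁ v) u = indicator (u ≟ v)
  potential (inj₂ e) u = indicator (u ≟ end₁ e) + indicator (u ≟ end₂ e)

  -- diff z w is the difference of two columns.  By multilinearity it may be replaced by one of
  -- the two, so a matrix with such columns uses both z and w.
  data Column : Set where
    one  : V ⊎ E → Column
    diff : V ⊎ E → V ⊎ E → Column

  columnPotential : Column → V → ℤ
  columnPotential (one z)    u = potential z u
  columnPotential (diff z w) u = potential z u - potential w u

  indices : List Column → List (V ⊎ E)
  indices []              = []
  indices (one z ∷ cs)    = z ∷ indices cs
  indices (diff z w ∷ cs) = z ∷ w ∷ indices cs

  indices-++ : ∀ cs cs′ → indices (cs ++ cs′) ≡ indices cs ++ indices cs′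
  indices-++ []              cs′ = refl
  indices-++ (one z ∷ cs)    cs′ = cong (z ∷_) (indices-++ cs cs′)
  indices-++ (diff z w ∷ cs) cs′ = cong (λ zs → z ∷ w ∷ zs) (indices-++ cs cs′)

  indices-one : ∀ zs → indices (map one zs) ≡ zs
  indices-one []       = refl
  indices-one (z ∷ zs) = cong (z ∷_) (indices-one zs)

-- Rows and blocks in an oriented graph.

module Oriented (G : Graph) (o : Orientation G) where
  open Graph G
  open Orientation o
  open Potentials G
  open DecMembership {A = V} _≟_ using (_∈?_)
  open Permanents ℤ.+-*-commutativeRing using (per; per-column-+)
  open import Data.Integer.Base using (_+_; _-_)

  entry : E → Column → ℤ
  entry e c = columnPotential c (head e) - columnPotential c (tail e)

  potential-edge : ∀ e u → potential (inj₂ e) u ≡ indicator (u ≟ tail e) + indicator (u ≟ head e)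
  potential-edge e u with joins e
  ... | inj₁ (p , q) rewrite p | q = refl
  ... | inj₂ (p , q) rewrite p | q = ℤ.+-comm (indicator (u ≟ head e)) _

  joins⇒arc : ∀ {e u v} → Joins e u v → (tail e ≡ u × head e ≡ v) ⊎ (tail e ≡ v × head e ≡ u)
  joins⇒arc {e} j with joins e | j
  ... | inj₁ (p , q) | inj₁ (r , s) = inj₁ (trans (sym p) r , trans (sym q) s)
  ... | inj₁ (p , q) | inj₂ (r , s) = inj₂ (trans (sym p) r , trans (sym q) s)
  ... | inj₂ (p , q) | inj₁ (r , s) = inj₂ (trans (sym q) s , trans (sym p) r)
  ... | inj₂ (p , q) | inj₂ (r , s) = inj₁ (trans (sym q) s , trans (sym p) r)

  tail≢head : ∀ e → tail e ≢ head e
  tail≢head e eq with joins e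
  ... | inj₁ (p , q) = loopless e (trans p (trans eq (sym q)))
  ... | inj₂ (p , q) = loopless e (trans p (trans (sym eq) (sym q)))

  outEdges : V → List E
  outEdges v = filter (λ e → tail e ≟ v) (allFin size)

  ∈-outEdges⁺ : ∀ {e v} → tail e ≡ v → e ∈ outEdges v
  ∈-outEdges⁺ {e} = ∈-filter⁺ _ (∈-allFin e)

  ∈-outEdges⁻ : ∀ {e v} → e ∈ outEdges v → tail e ≡ v
  ∈-outEdges⁻ {v = v} e∈ = proj₂ (∈-filter⁻ (λ e → tail e ≟ v) {xs = allFin size} e∈)

  outEdges-unique : ∀ v → Unique (outEdges v)
  outEdges-unique v = Unique.filter⁺ _ (Unique.allFin⁺ size)

  rows : List V → List E
  rows = concatMap outEdges

  ∈-rows⁺ : ∀ {e S} → tail e ∈ S → e ∈ rows S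
  ∈-rows⁺ t∈S = ∈-concatMap⁺ outEdges (lose t∈S (∈-outEdges⁺ refl))

  ∈-rows⁻ : ∀ {e S} → e ∈ rows S → tail e ∈ S
  ∈-rows⁻ {S = S} e∈ with find (∈-concatMap⁻ outEdges {xs = S} e∈)
  ... | v , v∈S , e∈v = subst (_∈ S) (sym (∈-outEdges⁻ e∈v)) v∈S

  rows-unique : ∀ {S} → Unique S → Unique (rows S)
  rows-unique S! = Unique.concat⁺
    (All.map⁺ (All.universal outEdges-unique _))
    (AllPairs.map⁺ (AllPairs.map (λ u≢v {_} (e∈u , e∈v) → u≢v (trans (sym (∈-outEdges⁻ e∈u)) (∈-outEdges⁻ e∈v))) S!))

  -- Blocks with disjoint sets of owners use disjoint sets of columns.
  owner : V ⊎ E → V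
  owner = [ id , tail ]′

  -- The induction hypothesis on a set `S` of remaining vertices. Differences are still allowed as
  -- columns; both indices of a difference count as used.
  record Solvable (S : List V) : Set where
    field
      columns : List Column
      distinct : Unique (indices columns)
      owned    : ∀ {z} → z ∈ indices columns → owner z ∈ S
      per≢0    : per entry (rows S) columns ≢ 0ℤ

  infixl 6 _∖_
  _∖_ : List V → List V → List V
  S ∖ X = filter (λ v → ¬? (v ∈? X)) S

  -- A block X of k vertices seen from inside: an edge with tail in X is given by the index of its
  -- tail and that of its head, nothing if the head is outside X; a column is given by a potential
  -- on X, extended by 0.  The permanent of a block then computes.
  LocalRow : ∀ k → Set
  LocalRow k = Fin k × Maybe (Fin k)

  LocalColumn : ∀ k → Set
  LocalColumn k = Fin k → ℤ

  localEntry : ∀ {k} → LocalRow k → LocalColumn k → ℤ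
  localEntry (t , h) φ = maybe φ 0ℤ h - φ t

  basis : ∀ {k} → Fin k → LocalColumn k
  basis i j = indicator (j ≟ i)

  module _ (X : List V) where

    HeadLike : V → Maybe (Fin (length X)) → Set
    HeadLike v (just i) = v ≡ lookup X i
    HeadLike v nothing  = v ∉ X

    RowLike : E → LocalRow (length X) → Set
    RowLike e (t , h) = tail e ≡ lookup X t × HeadLike (head e) h

    -- The vanishing outside `X` serves twice: it justifies the value 0 at heads outside the block,
    -- and it makes the rows of all other vertices vanish when no edge enters `X`.
    Restricts : (V → ℤ) → LocalColumn (length X) → Set
    Restricts φ ψ = (∀ i → φ (lookup X i) ≡ ψ i) × (∀ {v} → v ∉ X → φ v ≡ 0ℤ)

    ColumnLike : Column → LocalColumn (length X) → Set
    ColumnLike c = Restricts (columnPotential c)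

    head-restricts : ∀ {v h φ ψ} → HeadLike v h → Restricts φ ψ → φ v ≡ maybe ψ 0ℤ h
    head-restricts {h = just i}  refl (on , _) = on i
    head-restricts {h = nothing} v∉X (_ , off) = off v∉X

    entry-local : ∀ {e l c ψ} → RowLike e l → ColumnLike c ψ → entry e c ≡ localEntry l ψ
    entry-local {c = c} (t , h) r@(on , _) =
      cong₂ _-_ (head-restricts h r) (trans (cong (columnPotential c) t) (on _))

    module _ (X! : Unique X) where

      restricts-basis : ∀ i → Restricts (λ u → indicator (u ≟ lookup X i)) (basis i)
      restricts-basis i =
        (λ j → indicator-cong (lookup X j ≟ lookup X i) (j ≟ i) (lookup-injective X!) (cong (lookup X))) ,
        (λ {v} v∉X → indicator-no (v ≟ lookup X i) λ { refl → v∉X (∈-lookup i) })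

      innerEdge : ∀ {e} i j → tail e ≡ lookup X i → head e ≡ lookup X j →
                  ColumnLike (one (inj₂ e)) (λ k → basis i k + basis j k)
      innerEdge {e} i j t h with restricts-basis i | restricts-basis j
      ... | on , off | on′ , off′ rewrite sym t | sym h =
        (λ k → trans (potential-edge e (lookup X k)) (cong₂ _+_ (on k) (on′ k))) ,
        (λ {v} v∉X → trans (potential-edge e v) (cong₂ _+_ (off v∉X) (off′ v∉X)))

      -- The common head cancels, whether or not it lies in X.
      edgeDifference : ∀ {e f} i j → tail e ≡ lookup X i → tail f ≡ lookup X j → head e ≡ head f →
                       ColumnLike (diff (inj₂ e) (inj₂ f)) (λ k → basis i k - basis j k)
      edgeDifference {e} {f} i j t t′ h with restricts-basis i | restricts-basis j
      ... | on , off | on′ , off′ rewrite sym t | sym t′ =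
        (λ k → trans (cancel (lookup X k)) (cong₂ _-_ (on k) (on′ k))) ,
        (λ {v} v∉X → trans (cancel v) (cong₂ _-_ (off v∉X) (off′ v∉X)))
        where
        a-c : ∀ a b c → (a + c) - (b + c) ≡ a - b
        a-c = solve 3 (λ a b c → (a :+ c) :- (b :+ c) := a :- b) refl
          where open +-*-Solver
        cancel : ∀ u → potential (inj₂ e) u - potential (inj₂ f) u ≡
                       indicator (u ≟ tail e) - indicator (u ≟ tail f)
        cancel u = trans
          (cong₂ _-_ (potential-edge e u)
            (trans (potential-edge f u) (cong (λ w → indicator (u ≟ tail f) + indicator (u ≟ w)) (sym h))))
          (a-c (indicator (u ≟ tail e)) (indicator (u ≟ tail f)) (indicator (u ≟ head e)))

      vertexColumns : Pointwise ColumnLike (map (one ∘ inj₁) X) (tabulate basis)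
      vertexColumns = subst (λ cs → Pointwise ColumnLike cs (tabulate basis))
        (trans (sym (map-tabulate (lookup X) (one ∘ inj₁))) (cong (map (one ∘ inj₁)) (tabulate-lookup X)))
        (Pointwise.tabulate⁺ restricts-basis)

  -- From differences of columns to single columns.

  entry-diff : ∀ z w e → entry e (one z) ≡ entry e (diff z w) + entry e (one w)
  entry-diff z w e = solve 4
    (λ a b c d → a :- b := ((a :- c) :- (b :- d)) :+ (c :- d)) refl
    (potential z (head e)) (potential z (tail e)) (potential w (head e)) (potential w (tail e))
    where open +-*-Solver

  -- By multilinearity the permanent with `one z` is the sum of those with `diff z w` and `one w`,
  -- so if the middle one is nonzero, `z` or `w` will do. The prefix `cs` holds the columns already
  -- settled. The result is a sublist of the indices, hence inherits their distinctness.
  chooseIndices : ∀ es cs cs′ → per entry es (cs ++ cs′) ≢ 0ℤ →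
    ∃ λ zs → zs ⊆ indices cs′ × per entry es (cs ++ map one zs) ≢ 0ℤ
  chooseIndices es cs []           per≢0 = [] , [] , per≢0
  chooseIndices es cs (one z ∷ cs′) per≢0
    with chooseIndices es (cs ++ one z ∷ []) cs′ (subst (λ l → per entry es l ≢ 0ℤ) (sym (++-assoc cs _ cs′)) per≢0)
  ... | zs , zs⊆ , per≢0′ = z ∷ zs , refl ∷ zs⊆ , subst (λ l → per entry es l ≢ 0ℤ) (++-assoc cs _ _) per≢0′
  chooseIndices es cs (diff z w ∷ cs′) per≢0 with per entry es (cs ++ one z ∷ cs′) ℤ.≟ 0ℤ
  ... | no per≢0′ with chooseIndices es cs (one z ∷ cs′) per≢0′
  ...   | zs , zs⊆ , per≢0″ = zs , weaken zs⊆ , per≢0″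
    where
    weaken : ∀ {zs} → zs ⊆ z ∷ indices cs′ → zs ⊆ z ∷ w ∷ indices cs′
    weaken (_ ∷ʳ p)   = z ∷ʳ w ∷ʳ p
    weaken (refl ∷ p) = refl ∷ (w ∷ʳ p)
  chooseIndices es cs (diff z w ∷ cs′) per≢0 | yes per≡0 with chooseIndices es cs (one w ∷ cs′) per≢0′
    where
    per≢0′ : per entry es (cs ++ one w ∷ cs′) ≢ 0ℤ
    per≢0′ per≡0′ = per≢0 (begin
      per entry es (cs ++ diff z w ∷ cs′)      ≡⟨ ℤ.+-identityʳ _ ⟨
      per entry es (cs ++ diff z w ∷ cs′) + 0ℤ ≡⟨ cong (λ i → per entry es (cs ++ diff z w ∷ cs′) + i) per≡0′ ⟨
      per entry es (cs ++ diff z w ∷ cs′) + per entry es (cs ++ one w ∷ cs′)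
        ≡⟨ per-column-+ entry (entry-diff z w) es cs cs′ ⟨
      per entry es (cs ++ one z ∷ cs′)         ≡⟨ per≡0 ⟩
      0ℤ                                       ∎)
      where open ≡-Reasoning
  ... | zs , zs⊆ , per≢0″ = zs , z ∷ʳ zs⊆ , per≢0″

listProduct≢0 : ∀ {a} {A : Set a} (f : A → ℤ) xs → (∀ x → f x ≢ 0ℤ) →
                 Permanents.listProduct ℤ.+-*-commutativeRing f xs ≢ 0ℤ
listProduct≢0 f []       f≢0 ()
listProduct≢0 f (x ∷ xs) f≢0 eq = [ f≢0 x , listProduct≢0 f xs f≢0 ]′ (ℤ.i*j≡0⇒i≡0∨j≡0 (f x) eq)

-- Arcs of a 2-tree.

module TwoTrees (G : Graph) (T : IsTwoTree G) where
  open Graph G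
  open IsTwoTree T
  open Orientation orientation
  open Oriented G orientation
  open Potentials G
  open DecMembership {A = V} _≟_ using (_∈?_)
  open Permanents ℤ.+-*-commutativeRing using (per; per-pointwise; per-↭; per-block; per-length; per-scaleRows; listProduct)
  open import Data.Integer.Base using (_+_; _-_; _*_)

  tail≢v₀ : ∀ e → tail e ≢ v₀
  tail≢v₀ e t≡v₀ with outEdges v₀ | outDegree₀ | ∈-outEdges⁺ {e} t≡v₀
  ... | [] | _ | ()

  data OutEdges (v : V) : Set where
    root  : ∀ {f} → outEdges v ≡ f ∷ [] → head f ≡ v₀ → OutEdges v
    inner : ∀ {f g} → outEdges v ≡ f ∷ g ∷ [] → f ≢ g → Adjacent (head f) (head g) → OutEdges v

  joins-unique : ∀ {f g} → tail f ≡ tail g → head f ≡ head g → f ≡ g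
  joins-unique {f} {g} t h = noParallel (joins f) (subst₂ (Joins g) (sym t) (sym h) (joins g))

  -- The edge between `v₀` and `v₁` cannot leave `v₀`, so it is the single out-edge of `v₁`; this is
  -- the case `root`.
  classify : ∀ {v} → v ≢ v₀ → OutEdges v
  classify {v} v≢v₀ with v ≟ v₁
  ... | yes refl with list₁ (outEdges v₁) outDegree₁ | v₀v₁
  ...   | f , out | e , j with joins⇒arc j
  ...     | inj₁ (t , _) = contradiction t (tail≢v₀ e)
  ...     | inj₂ (t , h) with subst (e ∈_) out (∈-outEdges⁺ t)
  ...       | here refl = root out h
  classify {v} v≢v₀ | no v≢v₁ with list₂ (outEdges v) (outDegree₂ v v≢v₀ v≢v₁)
  ... | f , g , out = inner out f≢g
    (outAdjacent v v≢v₀ v≢v₁ (f , tail-f , refl) (g , tail-g , refl)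
      λ h → f≢g (joins-unique (trans tail-f (sym tail-g)) h))
    where
    tail-f : tail f ≡ v
    tail-f = ∈-outEdges⁻ (subst (f ∈_) (sym out) (here refl))
    tail-g : tail g ≡ v
    tail-g = ∈-outEdges⁻ (subst (g ∈_) (sym out) (there (here refl)))
    f≢g : f ≢ g
    f≢g with subst Unique out (outEdges-unique v)
    ... | (f≢g ∷ _) ∷ _ = f≢g

  arc? : ∀ u v → Dec (Arc u v)
  arc? u v = any? λ e → (tail e ≟ u) ×-dec (head e ≟ v)

  -- Acyclicity makes reachability a strict partial order, which is well-founded on a finite set.
  -- Descent goes from a vertex to its in-neighbours.
  arcs-wellFounded : WellFounded (TransClosure Arc)
  arcs-wellFounded = spo-wellFounded {_≈_ = _≡_} record
    { isEquivalence = ≡.isEquivalence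
    ; irrefl        = λ { refl → acyclic _ }
    ; trans         = Plus._++_
    ; <-resp-≈      = resp₂ _
    }

  Closed : List V → Set
  Closed S = ∀ e → tail e ∈ S → head e ≡ v₀ ⊎ head e ∈ S

  -- Besides making the matrix block triangular, this keeps the rest of `S` closed when `X` is
  -- removed.
  NoEntering : List V → List V → Set
  NoEntering S X = ∀ e → tail e ∈ S → head e ∈ X → tail e ∈ X

  -- One induction step: the removable blocks, with `smaller` as induction hypothesis.

  module Reduction (S : List V) (S! : Unique S) (closed : Closed S) (v₀∉S : v₀ ∉ S)
    (smaller : ∀ X {x} → x ∈ X → x ∈ S → NoEntering S X → Solvable (S ∖ X)) where

    -- Since no edge enters X from S ∖ X, the rows of S ∖ X vanish on potentials supported on X,
    -- so the permanent is the product of that of the block X and that of S ∖ X.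
    remove : ∀ X {x} → x ∈ X → ∀ es rest columns {lrows lcolumns} → Unique X → (∀ {v} → v ∈ X → v ∈ S) →
      es ++ rest ↭ rows X → indices columns ≡ map inj₂ es →
      Pointwise (RowLike X) (es ++ rest) lrows → Pointwise (ColumnLike X) columns lcolumns →
      length lrows ≡ length X ℕ.+ length lcolumns →
      per localEntry lrows (tabulate basis ++ lcolumns) ≢ 0ℤ →
      NoEntering S X → Solvable S
    remove X x∈X es rest columns {lrows} {lcolumns} X! X⊆S rows↭ indices≡ rowLikes columnLikes len
      local≢0 noEntering = record
      { columns  = all
      ; distinct = subst Unique (sym all-indices) (Unique.++⁺
          (Unique.map⁺ inj₁-injective X!)
          (Unique.++⁺ (Unique.map⁺ inj₂-injective es!) Sol.distinct es-disjoint) X-disjoint)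
      ; owned    = λ z∈ → owned-all (subst (_ ∈_) all-indices z∈)
      ; per≢0    = λ per≡0 → [ local≢0 ∘ trans (sym per-local) , Sol.per≢0 ]′
          (ℤ.i*j≡0⇒i≡0∨j≡0 (per entry (es ++ rest) block) (trans (sym per-all) per≡0))
      }
      where
      module Sol = Solvable (smaller X x∈X (X⊆S x∈X) noEntering)
      vertices block all : List Column
      vertices = map (one ∘ inj₁) X
      block = vertices ++ columns
      all = block ++ Sol.columns

      ∈-S∖X : ∀ {v} → v ∈ S ∖ X → v ∈ S × v ∉ X
      ∈-S∖X = ∈-filter⁻ (λ v → ¬? (v ∈? X))

      S∖X! : Unique (S ∖ X)
      S∖X! = Unique.filter⁺ _ S!

      es++rest! : Unique (es ++ rest)
      es++rest! = Unique-↭ (↭-sym rows↭) (rows-unique X!)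

      es! : Unique es
      es! = Unique-++⁻ˡ es es++rest!

      tail-es : ∀ {e} → e ∈ es → tail e ∈ X
      tail-es e∈ = ∈-rows⁻ {S = X} (∈-resp-↭ rows↭ (∈-++⁺ˡ e∈))

      -- All vertices of `X` and the edges in `es` are used as columns; the edges in `rest` occur as
      -- rows only.
      all-indices : indices all ≡ map inj₁ X ++ map inj₂ es ++ indices Sol.columns
      all-indices = begin
        indices ((vertices ++ columns) ++ Sol.columns)   ≡⟨ cong indices (++-assoc vertices columns _) ⟩
        indices (vertices ++ columns ++ Sol.columns)     ≡⟨ indices-++ vertices _ ⟩
        indices vertices ++ indices (columns ++ Sol.columns)
          ≡⟨ cong₂ _++_ (trans (cong indices (map-∘ X)) (indices-one (map inj₁ X)))
                       (trans (indices-++ columns _) (cong (_++ _) indices≡)) ⟩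
        map inj₁ X ++ map inj₂ es ++ indices Sol.columns ∎
        where open ≡-Reasoning

      es-disjoint : Disjoint (map inj₂ es) (indices Sol.columns)
      es-disjoint (z∈ , z∈′) with ∈-map⁻ inj₂ z∈
      ... | e , e∈ , refl = proj₂ (∈-S∖X (Sol.owned z∈′)) (tail-es e∈)

      X-disjoint : Disjoint (map inj₁ X) (map inj₂ es ++ indices Sol.columns)
      X-disjoint (z∈ , z∈′) with ∈-map⁻ inj₁ z∈ | ∈-++⁻ (map inj₂ es) z∈′
      ... | v , v∈ , refl | inj₂ z∈″ = proj₂ (∈-S∖X (Sol.owned z∈″)) v∈
      ... | v , v∈ , refl | inj₁ z∈″ with ∈-map⁻ inj₂ z∈″
      ...   | _ , _ , ()

      owned-all : ∀ {z} → z ∈ map inj₁ X ++ map inj₂ es ++ indices Sol.columns → owner z ∈ S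
      owned-all z∈ with ∈-++⁻ (map inj₁ X) z∈
      ... | inj₁ z∈X with ∈-map⁻ inj₁ z∈X
      ...   | v , v∈ , refl = X⊆S v∈
      owned-all z∈ | inj₂ z∈′ with ∈-++⁻ (map inj₂ es) z∈′
      ... | inj₂ z∈″ = proj₁ (∈-S∖X (Sol.owned z∈″))
      ... | inj₁ z∈es with ∈-map⁻ inj₂ z∈es
      ...   | e , e∈ , refl = X⊆S (tail-es e∈)

      rows-split : rows S ↭ (es ++ rest) ++ rows (S ∖ X)
      rows-split = unique∧⇔⇒↭ (rows-unique S!)
        (Unique.++⁺ es++rest! (rows-unique S∖X!) λ (e∈ , e∈′) →
          proj₂ (∈-S∖X (∈-rows⁻ e∈′)) (∈-rows⁻ {S = X} (∈-resp-↭ rows↭ e∈)))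
        to from
        where
        to : ∀ {e} → e ∈ rows S → e ∈ (es ++ rest) ++ rows (S ∖ X)
        to {e} e∈ with tail e ∈? X
        ... | yes t∈X = ∈-++⁺ˡ (∈-resp-↭ (↭-sym rows↭) (∈-rows⁺ t∈X))
        ... | no  t∉X = ∈-++⁺ʳ (es ++ rest) (∈-rows⁺ (∈-filter⁺ _ (∈-rows⁻ {S = S} e∈) t∉X))
        from : ∀ {e} → e ∈ (es ++ rest) ++ rows (S ∖ X) → e ∈ rows S
        from e∈ with ∈-++⁻ (es ++ rest) e∈
        ... | inj₁ e∈X = ∈-rows⁺ (X⊆S (∈-rows⁻ {S = X} (∈-resp-↭ rows↭ e∈X)))
        ... | inj₂ e∈′ = ∈-rows⁺ (proj₁ (∈-S∖X (∈-rows⁻ e∈′)))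

      blockLikes : Pointwise (ColumnLike X) block (tabulate basis ++ lcolumns)
      blockLikes = Pointwise.++⁺ (vertexColumns X X!) columnLikes

      zero-outside : ∀ {e c} → e ∈ rows (S ∖ X) → c ∈ block → entry e c ≡ 0ℤ
      zero-outside {e} {c} e∈ c∈ with ∈-S∖X (∈-rows⁻ e∈) | pointwise-∈ blockLikes c∈
        where
        pointwise-∈ : ∀ {cs φs} → Pointwise (ColumnLike X) cs φs → c ∈ cs → ∃ (ColumnLike X c)
        pointwise-∈ (p ∷ ps) (here refl) = _ , p
        pointwise-∈ (p ∷ ps) (there c∈)  = pointwise-∈ ps c∈
      ... | t∈S , t∉X | φ , _ , off = cong₂ _-_ (off (t∉X ∘ noEntering e t∈S)) (off t∉X)

      lengths : length (es ++ rest) ≡ length block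
      lengths = begin
        length (es ++ rest)                     ≡⟨ Pointwise.Pointwise-length rowLikes ⟩
        length lrows                            ≡⟨ len ⟩
        length X ℕ.+ length lcolumns            ≡⟨ cong (ℕ._+ length lcolumns) (length-tabulate basis) ⟨
        length (tabulate {n = length X} basis) ℕ.+ length lcolumns ≡⟨ length-++ (tabulate {n = length X} basis) ⟨
        length (tabulate basis ++ lcolumns)     ≡⟨ Pointwise.Pointwise-length blockLikes ⟨
        length block                            ∎
        where open ≡-Reasoning

      per-all : per entry (rows S) all ≡ per entry (es ++ rest) block * per entry (rows (S ∖ X)) Sol.columns
      per-all = trans (per-↭ entry rows-split all)
        (per-block entry (es ++ rest) (rows (S ∖ X)) block Sol.columns lengths zero-outside)

      per-local : per entry (es ++ rest) block ≡ per localEntry lrows (tabulate basis ++ lcolumns)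
      per-local = per-pointwise (λ {_} {_} {c} r q → entry-local X {c = c} r q) rowLikes blockLikes

    -- Relative to the current `S`: arcs from vertices removed earlier do not count.
    Leaf : V → Set
    Leaf v = ∀ e → tail e ∈ S → head e ≢ v

    -- A leaf over the edge f, joined to the tail of f by a and to its head by b.
    record Kid (f : E) (v : V) : Set where
      field
        v∈S  : v ∈ S
        leaf : Leaf v
        {a b} : E
        out  : a ∷ b ∷ [] ↭ outEdges v
        head-a : head a ≡ tail f
        head-b : head b ≡ head f

      tail-a : tail a ≡ v
      tail-a = ∈-outEdges⁻ (∈-resp-↭ out (here refl))

      tail-b : tail b ≡ v
      tail-b = ∈-outEdges⁻ (∈-resp-↭ out (there (here refl)))

      a-to-S : tail a ∈ S
      a-to-S = subst (_∈ S) (sym tail-a) v∈S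

      b-to-S : tail b ∈ S
      b-to-S = subst (_∈ S) (sym tail-b) v∈S

    -- The block has the single entry -1, since `f` leaves the block. Here and in the other removals
    -- the local permanent evaluates to a nonzero numeral, so `λ ()` refutes that it is 0.
    remove-single : ∀ {f v} → v ∈ S → outEdges v ≡ f ∷ [] → Leaf v → Solvable S
    remove-single {f} {v} v∈S out leaf =
      remove (v ∷ []) (here refl) [] (f ∷ []) [] {(0F , nothing) ∷ []} {[]} ([] ∷ []) (λ { (here refl) → v∈S })
        (subst (λ es → f ∷ [] ↭ es ++ []) (sym out) ↭.refl) refl
        ((tail-f , λ { (here eq) → tail≢head f (trans tail-f (sym eq)) }) ∷ []) [] refl (λ ())
        λ { e t∈S (here eq) → contradiction eq (leaf e t∈S) }
      where
      tail-f : tail f ≡ v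
      tail-f = ∈-outEdges⁻ (subst (f ∈_) (sym out) (here refl))

    -- All four edges leave the block, and both differences restrict to the same potential on `X`.
    -- Equal columns do not annihilate a permanent: its value is -8.
    remove-twins : ∀ {f v w} → v ≢ w → Kid f v → Kid f w → Solvable S
    remove-twins {f} {v} {w} v≢w kv kw =
      remove X (here refl) (v.a ∷ w.a ∷ v.b ∷ w.b ∷ []) []
        (diff (inj₂ v.a) (inj₂ w.a) ∷ diff (inj₂ v.b) (inj₂ w.b) ∷ [])
        {(0F , nothing) ∷ (1F , nothing) ∷ (0F , nothing) ∷ (1F , nothing) ∷ []}
        {(λ k → basis 0F k - basis 1F k) ∷ (λ k → basis 0F k - basis 1F k) ∷ []}
        X! (λ { (here refl) → v.v∈S ; (there (here refl)) → w.v∈S })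
        (↭.trans (↭.prep _ (↭.swap _ _ ↭.refl)) (++⁺ v.out (++⁺ w.out ↭.refl))) refl
        ((v.tail-a , outside v.a-to-S) ∷ (w.tail-a , outside w.a-to-S) ∷
         (v.tail-b , outside v.b-to-S) ∷ (w.tail-b , outside w.b-to-S) ∷ [])
        (edgeDifference X X! 0F 1F v.tail-a w.tail-a (trans v.head-a (sym w.head-a)) ∷
         edgeDifference X X! 0F 1F v.tail-b w.tail-b (trans v.head-b (sym w.head-b)) ∷ [])
        refl (λ ())
        λ e t∈S h∈X → contradiction h∈X (outside t∈S)
      where
      module v = Kid kv
      module w = Kid kw
      X : List V
      X = v ∷ w ∷ []
      X! : Unique X
      X! = (v≢w ∷ []) ∷ [] ∷ []
      outside : ∀ {e} → tail e ∈ S → head e ∉ X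
      outside t∈S (here eq)         = v.leaf _ t∈S eq
      outside t∈S (there (here eq)) = w.leaf _ t∈S eq

    module _ {x} (x∈S : x ∈ S) {f} (tail-f : tail f ≡ x) where

      private
        out-of-x : ∀ {e} → tail e ≡ x → tail e ∈ S
        out-of-x t = subst (_∈ S) (sym t) x∈S

        head≢x : ∀ {e} → tail e ≡ x → head e ≢ x
        head≢x {e} t h = tail≢head e (trans t (sym h))

      module Pair {v} (kv : Kid f v) (only : ∀ e → tail e ∈ S → head e ≡ x → tail e ≡ v) where
        module v = Kid kv
        X : List V
        X = v ∷ x ∷ []

        v≢x : v ≢ x
        v≢x refl = tail≢head v.a (trans v.tail-a (sym (trans v.head-a tail-f)))

        X! : Unique X
        X! = (v≢x ∷ []) ∷ [] ∷ []

        outside : ∀ {e} → tail e ≡ x → head e ∉ X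
        outside t (here eq)         = v.leaf _ (out-of-x t) eq
        outside t (there (here eq)) = head≢x t eq

        outside-b : head v.b ∉ X
        outside-b = subst (_∉ X) (sym v.head-b) (outside tail-f)

        X⊆S : ∀ {u} → u ∈ X → u ∈ S
        X⊆S (here refl)         = v.v∈S
        X⊆S (there (here refl)) = x∈S

        noEntering : NoEntering S X
        noEntering e t∈S (here eq)         = contradiction eq (v.leaf e t∈S)
        noEntering e t∈S (there (here eq)) = here (only e t∈S eq)

        b-f : ColumnLike X (diff (inj₂ v.b) (inj₂ f)) (λ k → basis 0F k - basis 1F k)
        b-f = edgeDifference X X! 0F 1F v.tail-b tail-f v.head-b

        head-a : head v.a ≡ x
        head-a = trans v.head-a tail-f

        -- With one out-edge at `x` there are three rows, so besides the two vertices one column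
        -- suffices: the difference of `v.b` and `f`. The permanent is -4.
        remove-pair₁ : f ∷ [] ↭ outEdges x → Solvable S
        remove-pair₁ out = remove X (here refl) (v.b ∷ f ∷ []) (v.a ∷ []) (diff (inj₂ v.b) (inj₂ f) ∷ [])
          {(0F , nothing) ∷ (1F , nothing) ∷ (0F , just 1F) ∷ []}
          {(λ k → basis 0F k - basis 1F k) ∷ []}
          X! X⊆S (↭.trans (shift v.a (v.b ∷ f ∷ []) []) (++⁺ v.out (++⁺ out ↭.refl))) refl
          ((v.tail-b , outside-b) ∷ (tail-f , outside tail-f) ∷ (v.tail-a , head-a) ∷ [])
          (b-f ∷ []) refl (λ ()) noEntering

        -- The fourth row asks for one more column. The edge `v.a` has both ends in the block, so
        -- its own potential is supported there. The permanent is 6.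
        remove-pair₂ : ∀ {g} → f ∷ g ∷ [] ↭ outEdges x → Solvable S
        remove-pair₂ {g} out = remove X (here refl) (v.a ∷ v.b ∷ f ∷ []) (g ∷ [])
          (one (inj₂ v.a) ∷ diff (inj₂ v.b) (inj₂ f) ∷ [])
          {(0F , just 1F) ∷ (0F , nothing) ∷ (1F , nothing) ∷ (1F , nothing) ∷ []}
          {(λ k → basis 0F k + basis 1F k) ∷ (λ k → basis 0F k - basis 1F k) ∷ []}
          X! X⊆S (++⁺ v.out (++⁺ out ↭.refl)) refl
          ((v.tail-a , head-a) ∷ (v.tail-b , outside-b) ∷ (tail-f , outside tail-f) ∷ (tail-g , outside tail-g) ∷ [])
          (innerEdge X X! 0F 1F v.tail-a head-a ∷ b-f ∷ []) refl (λ ()) noEntering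
          where
          tail-g : tail g ≡ x
          tail-g = ∈-outEdges⁻ (∈-resp-↭ out (there (here refl)))

      -- No pair can be removed here, because the other leaf has an arc into `x`. The two edges into
      -- `x` lie inside the block and one difference completes the six columns. The permanent is
      -- -12.
      remove-triple : ∀ {g v w} → v ≢ w → Kid f v → Kid g w → f ∷ g ∷ [] ↭ outEdges x →
        (∀ e → tail e ∈ S → head e ≡ x → tail e ≡ v ⊎ tail e ≡ w) → Solvable S
      remove-triple {g} {v} {w} v≢w kv kw out only =
        remove X (here refl) (w.a ∷ v.a ∷ v.b ∷ f ∷ []) (w.b ∷ g ∷ [])
          (one (inj₂ w.a) ∷ one (inj₂ v.a) ∷ diff (inj₂ v.b) (inj₂ f) ∷ [])
          {(0F , just 2F) ∷ (1F , just 2F) ∷ (1F , nothing) ∷ (2F , nothing) ∷ (0F , nothing) ∷ (2F , nothing) ∷ []}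
          {(λ k → basis 0F k + basis 2F k) ∷ (λ k → basis 1F k + basis 2F k) ∷
           (λ k → basis 1F k - basis 2F k) ∷ []}
          X! (λ { (here refl) → w.v∈S ; (there (here refl)) → v.v∈S ; (there (there (here refl))) → x∈S })
          (↭.trans (↭.prep _ (shift w.b (v.a ∷ v.b ∷ f ∷ []) (g ∷ []))) (++⁺ w.out (++⁺ v.out (++⁺ out ↭.refl)))) refl
          ((w.tail-a , head-wa) ∷ (v.tail-a , head-va) ∷
           (v.tail-b , subst (_∉ X) (sym v.head-b) (outside tail-f)) ∷ (tail-f , outside tail-f) ∷
           (w.tail-b , subst (_∉ X) (sym w.head-b) (outside tail-g)) ∷ (tail-g , outside tail-g) ∷ [])
          (innerEdge X X! 0F 2F w.tail-a head-wa ∷ innerEdge X X! 1F 2F v.tail-a head-va ∷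
           edgeDifference X X! 1F 2F v.tail-b tail-f v.head-b ∷ [])
          refl (λ ()) noEntering
        where
        module v = Kid kv
        module w = Kid kw
        X : List V
        X = w ∷ v ∷ x ∷ []
        tail-g : tail g ≡ x
        tail-g = ∈-outEdges⁻ (∈-resp-↭ out (there (here refl)))
        head-va : head v.a ≡ x
        head-va = trans v.head-a tail-f
        head-wa : head w.a ≡ x
        head-wa = trans w.head-a tail-g
        v≢x : v ≢ x
        v≢x refl = tail≢head v.a (trans v.tail-a (sym head-va))
        w≢x : w ≢ x
        w≢x refl = tail≢head w.a (trans w.tail-a (sym head-wa))
        X! : Unique X
        X! = ((v≢w ∘ sym) ∷ w≢x ∷ []) ∷ (v≢x ∷ []) ∷ [] ∷ []
        outside : ∀ {e} → tail e ≡ x → head e ∉ X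
        outside t (here eq)                 = w.leaf _ (out-of-x t) eq
        outside t (there (here eq))         = v.leaf _ (out-of-x t) eq
        outside t (there (there (here eq))) = head≢x t eq
        noEntering : NoEntering S X
        noEntering e t∈S (here eq)         = contradiction eq (w.leaf e t∈S)
        noEntering e t∈S (there (here eq)) = contradiction eq (v.leaf e t∈S)
        noEntering e t∈S (there (there (here eq))) with only e t∈S eq
        ... | inj₁ t≡v = there (here t≡v)
        ... | inj₂ t≡w = here t≡w

    -- Finding a removable block.

    S≢v₀ : ∀ {v} → v ∈ S → v ≢ v₀
    S≢v₀ v∈S refl = v₀∉S v∈S

    -- An edge into x from S whose tail is not a leaf leads further up; acyclicity stops this.
    topParent : ∀ {x} → Acc (TransClosure Arc) x → x ∈ S → (∃ λ e → tail e ∈ S × head e ≡ x) →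
      ∃ λ y → y ∈ S × (∃ λ e → tail e ∈ S × head e ≡ y) × (∀ e → tail e ∈ S → head e ≡ y → Leaf (tail e))
    topParent {x} (acc rec) x∈S entering with any? (λ e → (tail e ∈? S) ×-dec ((head e ≟ x) ×-dec
                                              any? (λ e′ → (tail e′ ∈? S) ×-dec (head e′ ≟ tail e))))
    ... | yes (e , t∈S , h , e′) = topParent (rec (Plus.[ e , refl , h ])) t∈S e′
    ... | no none = x , x∈S , entering , λ e t∈S h e′ t′∈S h′ → none (e , t∈S , h , e′ , t′∈S , h′)

    module _ {x} (x∈S : x ∈ S) (leaves : ∀ e → tail e ∈ S → head e ≡ x → Leaf (tail e)) where

      kids : E → List V
      kids f = filter (λ v → arc? v x ×-dec arc? v (head f)) S

      kids! : ∀ f → Unique (kids f)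
      kids! f = Unique.filter⁺ _ S!

      isKid : ∀ {f v} → tail f ≡ x → v ∈ kids f → Kid f v
      isKid {f} {v} tail-f v∈ with ∈-filter⁻ (λ v → arc? v x ×-dec arc? v (head f)) {xs = S} v∈
      ... | v∈S , (a , tail-a , head-a) , (b , tail-b , head-b) = record
        { v∈S = v∈S ; leaf = subst Leaf tail-a (leaves a (subst (_∈ S) (sym tail-a) v∈S) head-a)
        ; out = out (classify (S≢v₀ v∈S)) ; head-a = trans head-a (sym tail-f) ; head-b = head-b }
        where
        a≢b : a ≢ b
        a≢b refl = tail≢head f (trans tail-f (trans (sym head-a) head-b))
        out : OutEdges v → a ∷ b ∷ [] ↭ outEdges v
        out (root eq _) with subst (a ∈_) eq (∈-outEdges⁺ tail-a) | subst (b ∈_) eq (∈-outEdges⁺ tail-b)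
        ... | here refl | here refl = contradiction refl a≢b
        out (inner eq _ _) with subst (a ∈_) eq (∈-outEdges⁺ tail-a) | subst (b ∈_) eq (∈-outEdges⁺ tail-b)
        ... | here refl         | here refl         = contradiction refl a≢b
        ... | here refl         | there (here refl) = ↭.↭-reflexive (sym eq)
        ... | there (here refl) | here refl         = ↭.trans (↭.swap _ _ ↭.refl) (↭.↭-reflexive (sym eq))
        ... | there (here refl) | there (here refl) = contradiction refl a≢b

      -- The two out-neighbours of a leaf above x are joined by an edge; it starts at x,
      -- since otherwise x would have an in-neighbour which is not a leaf.
      onSomeEdge : ∀ e → tail e ∈ S → head e ≡ x → ∃ λ f → tail f ≡ x × tail e ∈ kids f
      onSomeEdge e t∈S h = from (classify (S≢v₀ t∈S))
        where
        via : ∀ b k → tail b ≡ tail e →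
              (tail k ≡ head e × head k ≡ head b) ⊎ (tail k ≡ head b × head k ≡ head e) →
              ∃ λ f → tail f ≡ x × tail e ∈ kids f
        via b k tail-b (inj₁ (t , h′)) = k , trans t h ,
          ∈-filter⁺ _ t∈S ((e , refl , h) , (b , tail-b , sym h′))
        via b k tail-b (inj₂ (t , h′)) with closed b (subst (_∈ S) (sym tail-b) t∈S)
        ... | inj₁ h≡v₀ = contradiction (trans t h≡v₀) (tail≢v₀ k)
        ... | inj₂ h∈S  = contradiction (sym t) (leaves k (subst (_∈ S) (sym t) h∈S) (trans h′ h)
                                                   b (subst (_∈ S) (sym tail-b) t∈S))

        from : OutEdges (tail e) → ∃ λ f → tail f ≡ x × tail e ∈ kids f
        from (root eq head-f) with subst (e ∈_) eq (∈-outEdges⁺ refl)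
        ... | here refl = contradiction (subst (_∈ S) (trans (sym h) head-f) x∈S) v₀∉S
        from (inner {a} {b} eq _ (k , ab)) with subst (e ∈_) eq (∈-outEdges⁺ refl)
        ... | here refl         = via b k (∈-outEdges⁻ (subst (b ∈_) (sym eq) (there (here refl)))) (joins⇒arc ab)
        ... | there (here refl) = via a k (∈-outEdges⁻ (subst (a ∈_) (sym eq) (here refl))) (Sum.swap (joins⇒arc ab))

      twins : ∀ {f v w ws} → tail f ≡ x → kids f ≡ v ∷ w ∷ ws → Solvable S
      twins {f} {v} {w} tail-f eq = remove-twins v≢w
        (isKid tail-f (subst (v ∈_) (sym eq) (here refl)))
        (isKid tail-f (subst (w ∈_) (sym eq) (there (here refl))))
        where
        v≢w : v ≢ w
        v≢w with subst Unique eq (kids! f)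
        ... | (v≢w ∷ _) ∷ _ = v≢w

      noKids : ∀ {f v} → kids f ≡ [] → v ∉ kids f
      noKids eq v∈ with subst (_ ∈_) eq v∈
      ... | ()

      onlyKid : ∀ {f v w} → kids f ≡ w ∷ [] → v ∈ kids f → v ≡ w
      onlyKid eq v∈ with subst (_ ∈_) eq v∈
      ... | here v≡w = v≡w

      theKid : ∀ {f w} → tail f ≡ x → kids f ≡ w ∷ [] → Kid f w
      theKid tail-f eq = isKid tail-f (subst (_ ∈_) (sym eq) (here refl))

      -- Two kids over one edge are twins. Otherwise each out-edge of `x` carries at most one kid,
      -- and by `onSomeEdge` the kids are all in-neighbours of `x` in `S`; their number decides
      -- between pair and triple.
      reduceAbove : (∃ λ e → tail e ∈ S × head e ≡ x) → Solvable S
      reduceAbove (e₀ , t₀ , h₀) with classify (S≢v₀ x∈S)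
      ... | root {f} out _ = cases (kids f) refl
        where
        tail-f : tail f ≡ x
        tail-f = ∈-outEdges⁻ (subst (f ∈_) (sym out) (here refl))
        onF : ∀ e → tail e ∈ S → head e ≡ x → tail e ∈ kids f
        onF e t∈S h with onSomeEdge e t∈S h
        ... | f′ , tail-f′ , e∈ with subst (f′ ∈_) out (∈-outEdges⁺ tail-f′)
        ...   | here refl = e∈
        cases : ∀ vs → kids f ≡ vs → Solvable S
        cases []          eq = contradiction (onF e₀ t₀ h₀) (noKids eq)
        cases (v ∷ [])    eq = Pair.remove-pair₁ x∈S tail-f (theKid tail-f eq)
          (λ e t∈S h → onlyKid eq (onF e t∈S h)) (↭.↭-reflexive (sym out))
        cases (_ ∷ _ ∷ _) eq = twins tail-f eq
      ... | inner {f} {g} out f≢g _ = cases (kids f) (kids g) refl refl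
        where
        tail-f : tail f ≡ x
        tail-f = ∈-outEdges⁻ (subst (f ∈_) (sym out) (here refl))
        tail-g : tail g ≡ x
        tail-g = ∈-outEdges⁻ (subst (g ∈_) (sym out) (there (here refl)))
        onFG : ∀ e → tail e ∈ S → head e ≡ x → tail e ∈ kids f ⊎ tail e ∈ kids g
        onFG e t∈S h with onSomeEdge e t∈S h
        ... | f′ , tail-f′ , e∈ with subst (f′ ∈_) out (∈-outEdges⁺ tail-f′)
        ...   | here refl         = inj₁ e∈
        ...   | there (here refl) = inj₂ e∈

        -- A common kid would have the three out-neighbours x, head f and head g.
        kids-differ : ∀ {v w} → Kid f v → Kid g w → v ≢ w
        kids-differ {v} kv kw refl = absurd (∈-resp-↭ (↭.trans v.out (↭-sym w.out)) (there (here refl)))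
          where
          module v = Kid kv
          module w = Kid kw
          absurd : v.b ∉ w.a ∷ w.b ∷ []
          absurd (here b≡a) = tail≢head f (begin
            tail f   ≡⟨ trans tail-f (sym tail-g) ⟩
            tail g   ≡⟨ w.head-a ⟨
            head w.a ≡⟨ cong head b≡a ⟨
            head v.b ≡⟨ v.head-b ⟩
            head f   ∎)
            where open ≡-Reasoning
          absurd (there (here b≡b)) = f≢g (joins-unique (trans tail-f (sym tail-g))
            (trans (sym v.head-b) (trans (cong head b≡b) w.head-b)))

        cases : ∀ vs ws → kids f ≡ vs → kids g ≡ ws → Solvable S
        cases (_ ∷ _ ∷ _) _ eq _ = twins tail-f eq
        cases _ (_ ∷ _ ∷ _) _ eq = twins tail-g eq
        cases []          []          eq eq′ =
          contradiction (onFG e₀ t₀ h₀) [ noKids eq , noKids eq′ ]′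
        cases (v ∷ [])    []          eq eq′ = Pair.remove-pair₂ x∈S tail-f (theKid tail-f eq)
          (λ e t∈S h → [ onlyKid eq , (λ e∈ → contradiction e∈ (noKids eq′)) ]′ (onFG e t∈S h))
          (↭.↭-reflexive (sym out))
        cases []          (w ∷ [])    eq eq′ = Pair.remove-pair₂ x∈S tail-g (theKid tail-g eq′)
          (λ e t∈S h → [ (λ e∈ → contradiction e∈ (noKids eq)) , onlyKid eq′ ]′ (onFG e t∈S h))
          (↭.trans (↭.swap _ _ ↭.refl) (↭.↭-reflexive (sym out)))
        cases (v ∷ [])    (w ∷ [])    eq eq′ =
          remove-triple x∈S tail-f (kids-differ kv kw) kv kw (↭.↭-reflexive (sym out))
            (λ e t∈S h → Sum.map (onlyKid eq) (onlyKid eq′) (onFG e t∈S h))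
          where
          kv = theKid tail-f eq
          kw = theKid tail-g eq′

    entered? : ∀ x → Dec (∃ λ e → tail e ∈ S × head e ≡ x)
    entered? x = any? λ e → (tail e ∈? S) ×-dec (head e ≟ x)

    climb : ∀ {x} → x ∈ S → (∃ λ e → tail e ∈ S × head e ≡ x) → Solvable S
    climb {x} x∈S entering with topParent (arcs-wellFounded x) x∈S entering
    ... | y , y∈S , entering′ , leaves = reduceAbove y∈S leaves entering′

    -- If `s` has two out-neighbours, the edge between them has its tail different from `v₀`, hence
    -- in `S`, and `s` is an in-neighbour of that tail: a place to start climbing. If `s` is `v₁`,
    -- either it has an in-neighbour or it is removed alone.
    reduce : ∀ {s} → s ∈ S → Solvable S
    reduce {s} s∈S with classify (S≢v₀ s∈S)
    ... | root {f} out _ with entered? s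
    ...   | yes entering = climb s∈S entering
    ...   | no  none     = remove-single s∈S out λ e t∈S h → none (e , t∈S , h)
    reduce {s} s∈S | inner {a} {b} out _ (k , ab) = via (joins⇒arc ab)
      where
      tail-a : tail a ≡ s
      tail-a = ∈-outEdges⁻ (subst (a ∈_) (sym out) (here refl))
      tail-b : tail b ≡ s
      tail-b = ∈-outEdges⁻ (subst (b ∈_) (sym out) (there (here refl)))
      from : ∀ c → tail c ≡ s → tail k ≡ head c → Solvable S
      from c tail-c t with closed c (subst (_∈ S) (sym tail-c) s∈S)
      ... | inj₁ h≡v₀ = contradiction (trans t h≡v₀) (tail≢v₀ k)
      ... | inj₂ h∈S  = climb h∈S (c , subst (_∈ S) (sym tail-c) s∈S , refl)
      via : (tail k ≡ head a × head k ≡ head b) ⊎ (tail k ≡ head b × head k ≡ head a) → Solvable S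
      via (inj₁ (t , _)) = from a tail-a t
      via (inj₂ (t , _)) = from b tail-b t

  -- Induction on the bound `n`: a block meets `S`, so its removal makes the list shorter.
  solvable : ∀ n S → length S ℕ.≤ n → Unique S → Closed S → v₀ ∉ S → Solvable S
  solvable _       []        _   _  _      _    = record { columns = [] ; distinct = [] ; owned = λ () ; per≢0 = λ () }
  solvable (suc n) S@(s ∷ _) len S! closed v₀∉S = Reduction.reduce S S! closed v₀∉S smaller (here refl)
    where
    smaller : ∀ X {x} → x ∈ X → x ∈ S → NoEntering S X → Solvable (S ∖ X)
    smaller X x∈X x∈S noEntering = solvable n (S ∖ X)
      (ℕ.≤-pred (ℕ.≤-trans (filter-notAll (λ v → ¬? (v ∈? X)) S (lose x∈S λ x∉X → x∉X x∈X)) len))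
      (Unique.filter⁺ (λ v → ¬? (v ∈? X)) S!)
      (λ e t∈ → let t∈S , t∉X = ∈-S∖X t∈ in
        Sum.map₂ (λ h∈S → ∈-filter⁺ (λ v → ¬? (v ∈? X)) h∈S (t∉X ∘ noEntering e t∈S)) (closed e t∈S))
      (v₀∉S ∘ proj₁ ∘ ∈-S∖X)
      where
      ∈-S∖X : ∀ {v} → v ∈ S ∖ X → v ∈ S × v ∉ X
      ∈-S∖X = ∈-filter⁻ (λ v → ¬? (v ∈? X))

  -- Distinct columns with nonzero permanent, for every orientation.

  indexEntry : Orientation G → E → V ⊎ E → ℤ
  indexEntry o e z = Oriented.entry G o e (one z)

  minor : Orientation G → (E → V ⊎ E) → ℤ
  minor o κ = per (indexEntry o) (allFin size) (tabulate κ)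

  -- Reversing an edge negates its row, so `s` is 1 or -1.
  entry-reorient : ∀ o e → ∃ λ s → s ≢ 0ℤ × ∀ c → Oriented.entry G o e c ≡ s * entry e c
  entry-reorient o e with Oriented.joins⇒arc G o (joins e)
  ... | inj₁ (t , h) = 1ℤ , (λ ()) , λ c → trans
    (cong₂ (λ u v → columnPotential c v - columnPotential c u) t h) (sym (ℤ.*-identityˡ _))
  ... | inj₂ (t , h) = -1ℤ , (λ ()) , λ c → trans
    (cong₂ (λ u v → columnPotential c v - columnPotential c u) t h)
    (solve 2 (λ a b → a :- b := con (-1ℤ) :* (b :- a)) refl (columnPotential c (tail e)) (columnPotential c (head e)))
    where open +-*-Solver

  nonbase : List V
  nonbase = filter (λ v → ¬? (v ≟ v₀)) (allFin order)

  solution : Solvable nonbase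
  solution = solvable (length nonbase) nonbase ℕ.≤-refl (Unique.filter⁺ _ (Unique.allFin⁺ order)) closed
    λ v₀∈ → proj₂ (∈-filter⁻ (λ v → ¬? (v ≟ v₀)) {xs = allFin order} v₀∈) refl
    where
    closed : ∀ e → tail e ∈ nonbase → head e ≡ v₀ ⊎ head e ∈ nonbase
    closed e _ with head e ≟ v₀
    ... | yes h≡v₀ = inj₁ h≡v₀
    ... | no  h≢v₀ = inj₂ (∈-filter⁺ _ (∈-allFin _) h≢v₀)

  -- No edge has its tail at `v₀`, so leaving `v₀` out loses no row.
  rows-nonbase : rows nonbase ↭ allFin size
  rows-nonbase = unique∧⇔⇒↭ (rows-unique (Unique.filter⁺ _ (Unique.allFin⁺ order))) (Unique.allFin⁺ size)
    (λ _ → ∈-allFin _)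
    (λ {e} _ → ∈-rows⁺ (∈-filter⁺ _ (∈-allFin _) (tail≢v₀ e)))

  -- The chosen indices have no repetition, and the nonzero permanent forces their number to be that
  -- of the edges, so they form an injective `κ`. The row signs carry the result from the given
  -- acyclic orientation to `o`.
  distinctIndices : ∀ o → ∃ λ (κ : E → V ⊎ E) → (∀ {i j} → κ i ≡ κ j → i ≡ j) ×
                    minor o κ ≢ 0ℤ
  distinctIndices o
    with chooseIndices (allFin size) [] (Solvable.columns solution)
           (Solvable.per≢0 solution ∘ trans (per-↭ (entry) rows-nonbase _))
  ... | zs , zs⊆ , per≢0 with unique⇒tabulate zs length-zs (Unique-⊆ zs⊆ (Solvable.distinct solution))
    where
    length-zs : length zs ≡ size
    length-zs with length zs ℕ.≟ size
    ... | yes eq = eq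
    ... | no ≢   = contradiction (per-length (entry) (allFin size) (map one zs)
      λ eq → ≢ (trans (sym (length-map one zs)) (trans (sym eq) (length-tabulate id)))) per≢0
  ... | κ , κ-injective , refl = κ , κ-injective , λ per≡0 →
    [ listProduct≢0 sign (allFin size) (λ e → proj₁ (proj₂ (entry-reorient o e))) , per≢0 ]′
      (ℤ.i*j≡0⇒i≡0∨j≡0 (listProduct sign (allFin size)) (trans (sym reorient) per≡0))
    where
    sign : E → ℤ
    sign e = proj₁ (entry-reorient o e)
    reorient : minor o κ ≡
               listProduct sign (allFin size) * per (entry) (allFin size) (map one (tabulate κ))
    reorient = trans
      (per-pointwise {_∼₁_ = _≡_} {_∼₂_ = λ z c → c ≡ one z} {indexEntry o}
        {λ e c → sign e * entry e c}
        (λ { {e} {y = z} refl refl → proj₂ (proj₂ (entry-reorient o e)) (one z) })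
        {allFin size} (Pointwise.refl refl) (pointwise-map one (tabulate κ)))
      (per-scaleRows (entry) sign (allFin size) (map one (tabulate κ)))

-- Order and apartness of the reals.

module _ {c ℓ₁ ℓ₂ ℓ₃} (ℝ : RealNumbers c ℓ₁ ℓ₂ ℓ₃) where
  open RealNumbers ℝ hiding (zero) renaming (refl to ≈-refl; sym to ≈-sym; trans to ≈-trans)
  open CommutativeRing commutativeRing using (ring; +-commutativeSemigroup)
  open RingProperties ring using (-‿distribˡ-*; -‿+-comm; -‿involutive)
  open CommutativeSemigroupProperties +-commutativeSemigroup
    using () renaming (interchange to +-medial; xy∙z≈xz∙y to +-swapʳ)
  open HeytingProperties heytingCommutativeRing using (1#0; x-0≈x; x#0y#0→xy#0; #-congʳ)
  open SetoidReasoning setoid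
  open Permanents commutativeRing
  open IntegerEmbedding commutativeRing
  private module < = IsStrictPartialOrder isStrictPartialOrder

  -- As 1 is apart from 0, the alternative is that 1 is negative. Then -1 is positive, and so is its
  -- square 1.
  0<1 : 0# < 1#
  0<1 with Equivalence.to #⇔<⊎> 1#0
  ... | inj₂ 0<1 = 0<1
  ... | inj₁ 1<0 = contradiction (<.trans 1<0 (<.<-respʳ-≈ square (*-positive 0<-1 0<-1))) (<.irrefl ≈-refl)
    where
    0<-1 : 0# < - 1#
    0<-1 = <.<-respˡ-≈ (-‿inverseʳ 1#) (<.<-respʳ-≈ (+-identityˡ _) (+-monoˡ-< (- 1#) 1<0))
    square : - 1# * - 1# ≈ 1#
    square = begin
      - 1# * - 1#   ≈⟨ -‿distribˡ-* 1# (- 1#) ⟨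
      - (1# * - 1#) ≈⟨ -‿cong (*-identityˡ _) ⟩
      - - 1#        ≈⟨ -‿involutive 1# ⟩
      1#            ∎

  0<ι : ∀ n → 0# < ι (+ suc n)
  0<ι ℕ.zero  = <.<-respʳ-≈ (≈-sym (+-identityʳ 1#)) 0<1
  0<ι (suc n) = <.trans (0<ι n) (<.<-respˡ-≈ (+-identityˡ _) (+-monoˡ-< (ι (+ suc n)) 0<1))

  -- Characteristic zero in terms of apartness: the order separates nonzero multiples of 1 from 0.
  ι#0 : ∀ {i} → i ≢ 0ℤ → ι i # 0#
  ι#0 {+ ℕ.zero}  i≢0 = contradiction refl i≢0
  ι#0 {+ suc n}   _   = Equivalence.from #⇔<⊎> (inj₂ (0<ι n))
  ι#0 { -[1+ n ]} _   = Equivalence.from #⇔<⊎> (inj₁ (<.<-respˡ-≈ (+-identityˡ _)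
    (<.<-respʳ-≈ (-‿inverseʳ _) (+-monoˡ-< (- ι (+ suc n)) (0<ι n)))))

  -- Apartness is invertibility of the difference, and subtracting 0 does not change which element
  -- is inverted.
  #⇒-#0 : ∀ {x y} → x # y → x - y # 0#
  #⇒-#0 x#y with #⇒invertible x#y
  ... | z , zl , zr = invertible⇒# (z , ≈-trans (*-congˡ (x-0≈x _)) zl , ≈-trans (*-congʳ (x-0≈x _)) zr)

  -#0⇒# : ∀ {x y} → x - y # 0# → x # y
  -#0⇒# x-y#0 with #⇒invertible x-y#0
  ... | z , zl , zr = invertible⇒# (z , ≈-trans (*-congˡ (≈-sym (x-0≈x _))) zl , ≈-trans (*-congʳ (≈-sym (x-0≈x _))) zr)

  -- If `z` inverts `x * y`, then `y * z` inverts `x`.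
  *#0⇒#0ˡ : ∀ {x y} → x * y # 0# → x # 0#
  *#0⇒#0ˡ {x} {y} xy#0 with #⇒invertible xy#0
  ... | z , zl , zr = invertible⇒# (y * z , ≈-trans (*-comm _ _) right , right)
    where
    right : (x - 0#) * (y * z) ≈ 1#
    right = begin
      (x - 0#) * (y * z) ≈⟨ *-congʳ (x-0≈x x) ⟩
      x * (y * z)        ≈⟨ *-assoc x y z ⟨
      x * y * z          ≈⟨ *-congʳ (x-0≈x (x * y)) ⟨
      (x * y - 0#) * z   ≈⟨ zr ⟩
      1#                 ∎

  *#0⇒#0ʳ : ∀ {x y} → x * y # 0# → y # 0#
  *#0⇒#0ʳ xy#0 = *#0⇒#0ˡ (#-congʳ (*-comm _ _) xy#0)

  listProduct#0 : ∀ {a} {A : Set a} (f : A → Carrier) xs → (∀ x → f x # 0#) → listProduct f xs # 0#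
  listProduct#0 f []       f#0 = 1#0
  listProduct#0 f (x ∷ xs) f#0 = x#0y#0→xy#0 (f#0 x) (listProduct#0 f xs f#0)

  listProduct#0⁻ : ∀ {a} {A : Set a} (f : A → Carrier) {xs x} → x ∈ xs → listProduct f xs # 0# → f x # 0#
  listProduct#0⁻ f (here refl) p = *#0⇒#0ˡ p
  listProduct#0⁻ f (there x∈)  p = listProduct#0⁻ f x∈ (*#0⇒#0ʳ p)

  -- The permanent as a sum over permutations and as a recursive expansion.

  private
    variable
      a b : Level
      A : Set a
      B : Set b

  sumOver-cong : ∀ (xs : List A) {g h} → (∀ {x} → x ∈ xs → g x ≈ h x) → sumOver ℝ xs g ≈ sumOver ℝ xs h
  sumOver-cong []       g≈h = ≈-refl
  sumOver-cong (x ∷ xs) g≈h = +-cong (g≈h (here refl)) (sumOver-cong xs (g≈h ∘ there))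

  sumOver-++ : ∀ (xs ys : List A) g → sumOver ℝ (xs ++ ys) g ≈ sumOver ℝ xs g + sumOver ℝ ys g
  sumOver-++ []       ys g = ≈-sym (+-identityˡ _)
  sumOver-++ (x ∷ xs) ys g = ≈-trans (+-congˡ (sumOver-++ xs ys g)) (≈-sym (+-assoc _ _ _))

  sumOver-map : ∀ (f : A → B) xs g → sumOver ℝ (map f xs) g ≡ sumOver ℝ xs (g ∘ f)
  sumOver-map f xs g = cong (foldr _+_ 0#) (sym (map-∘ xs))

  sumOver-concatMap : ∀ (f : A → List B) xs g →
                      sumOver ℝ (concatMap f xs) g ≈ sumOver ℝ xs λ x → sumOver ℝ (f x) g
  sumOver-concatMap f []       g = ≈-refl
  sumOver-concatMap f (x ∷ xs) g = ≈-trans (sumOver-++ (f x) _ g) (+-congˡ (sumOver-concatMap f xs g))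

  sumOver-*ˡ : ∀ k (xs : List A) g → sumOver ℝ xs (λ x → k * g x) ≈ k * sumOver ℝ xs g
  sumOver-*ˡ k []       g = ≈-sym (zeroʳ k)
  sumOver-*ˡ k (x ∷ xs) g = ≈-trans (+-congˡ (sumOver-*ˡ k xs g)) (≈-sym (distribˡ k _ _))

  -- The permutations are listed by the image `j` of `zero`, and `insert zero j σ` sends `suc i` to
  -- `punchIn j (σ ⟨$⟩ʳ i)` by computation.
  permanent-expand : ∀ {m} (M : Fin (suc m) → Fin (suc m) → Carrier) →
    permanent ℝ M ≈ sumOver ℝ (allFin (suc m)) λ j → M zero j * permanent ℝ λ i k → M (suc i) (punchIn j k)
  permanent-expand {m} M = ≈-trans
    (sumOver-concatMap (λ j → map (insert zero j) (permutations m)) (allFin (suc m)) term)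
    (sumOver-cong (allFin (suc m)) λ {j} _ → ≈-trans
      (reflexive (sumOver-map (insert zero j) (permutations m) term))
      (sumOver-*ˡ (M zero j) (permutations m) λ σ → product ℝ λ i → M (suc i) (punchIn j (σ ⟨$⟩ʳ i))))
    where
    term : Permutation′ (suc m) → Carrier
    term σ = product ℝ λ i → M i (σ ⟨$⟩ʳ i)

  sumPicks-tabulate : ∀ {m} (f : Fin (suc m) → A) g →
    sumPicks (tabulate f) g ≈ sumOver ℝ (allFin (suc m)) λ j → g (f j) (tabulate (f ∘ punchIn j))
  sumPicks-tabulate {m = ℕ.zero}  f g = ≈-refl
  sumPicks-tabulate {m = suc m} f g = +-congˡ (≈-trans
    (sumPicks-tabulate (f ∘ suc) λ y ys → g y (f zero ∷ ys))
    (reflexive (trans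
      (sym (sumOver-map suc (allFin (suc m)) rest))
      (cong (λ xs → sumOver ℝ xs rest) (map-tabulate {n = suc m} id suc)))))
    where
    rest : Fin (suc (suc m)) → Carrier
    rest j = g (f j) (tabulate (f ∘ punchIn j))

  permanent≈per : ∀ {m} (M : A → B → Carrier) (f : Fin m → A) (g : Fin m → B) →
                  permanent ℝ (λ i j → M (f i) (g j)) ≈ per M (tabulate f) (tabulate g)
  permanent≈per {m = ℕ.zero}  M f g = +-identityʳ 1#
  permanent≈per {m = suc m} M f g = begin
    permanent ℝ (λ i j → M (f i) (g j))
      ≈⟨ permanent-expand (λ i j → M (f i) (g j)) ⟩
    sumOver ℝ (allFin (suc m)) (λ j → M (f zero) (g j) * permanent ℝ λ i k → M (f (suc i)) (g (punchIn j k)))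
      ≈⟨ sumOver-cong (allFin (suc m)) (λ {j} _ → *-congˡ (permanent≈per M (f ∘ suc) (g ∘ punchIn j))) ⟩
    sumOver ℝ (allFin (suc m)) (λ j → M (f zero) (g j) * per M (tabulate (f ∘ suc)) (tabulate (g ∘ punchIn j)))
      ≈⟨ sumPicks-tabulate g (λ y ys → M (f zero) y * per M (tabulate (f ∘ suc)) ys) ⟨
    per M (tabulate f) (tabulate g) ∎

  -- The matrix `A_G` and the effect of changing one weight.

  module _ {n p} {P : Fin n → Set p} (P? : ∀ i → Dec (P i)) (g : Fin n → Carrier) (e : Fin n) (x : Carrier) where

    private
      g′ : Fin n → Carrier
      g′ i = if does (i ≟ e) then x else g i

      g′-other : ∀ {i} → i ≢ e → g′ i ≈ g i
      g′-other {i} i≢e with i ≟ e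
      ... | yes i≡e = contradiction i≡e i≢e
      ... | no  _   = ≈-refl

      g′-same : g′ e ≈ g e + (x - g e)
      g′-same with e ≟ e
      ... | no e≢e = contradiction refl e≢e
      ... | yes _  = begin
        x                 ≈⟨ +-identityˡ x ⟨
        0# + x            ≈⟨ +-congʳ (-‿inverseʳ (g e)) ⟨
        (g e - g e) + x   ≈⟨ +-assoc _ _ _ ⟩
        g e + (- g e + x) ≈⟨ +-congˡ (+-comm _ _) ⟩
        g e + (x - g e)   ∎

    -- As `is` has no repetition, `e` is met once; the indicator records whether it survives the
    -- filter. For incidence with a vertex this is the effect of an edge weight on the vertex sum.
    sumOver-update : ∀ {is} → Unique is → e ∈ is →
      sumOver ℝ (filter P? is) g′ ≈ sumOver ℝ (filter P? is) g + ι (indicator (P? e)) * (x - g e)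
    sumOver-update {i ∷ is} (e∉ ∷ _) (here refl) with P? e
    ... | yes _ = begin
      g′ e + sumOver ℝ (filter P? is) g′
        ≈⟨ +-cong g′-same unchanged ⟩
      (g e + (x - g e)) + sumOver ℝ (filter P? is) g
        ≈⟨ +-swapʳ _ _ _ ⟩
      (g e + sumOver ℝ (filter P? is) g) + (x - g e)
        ≈⟨ +-congˡ (≈-trans (*-congʳ ι-1) (*-identityˡ _)) ⟨
      (g e + sumOver ℝ (filter P? is) g) + ι 1ℤ * (x - g e) ∎
      where
      unchanged : sumOver ℝ (filter P? is) g′ ≈ sumOver ℝ (filter P? is) g
      unchanged = sumOver-cong (filter P? is) λ i∈ →
        g′-other (All.lookup e∉ (proj₁ (∈-filter⁻ P? {xs = is} i∈)) ∘ sym)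
    ... | no _ = ≈-trans
      (sumOver-cong (filter P? is) λ i∈ → g′-other (All.lookup e∉ (proj₁ (∈-filter⁻ P? {xs = is} i∈)) ∘ sym))
      (≈-sym (≈-trans (+-congˡ (zeroˡ _)) (+-identityʳ _)))
    sumOver-update {i ∷ is} (i∉ ∷ is!) (there e∈) with does (P? i)
    ... | true  = ≈-trans (+-cong (g′-other (All.lookup i∉ e∈)) (sumOver-update is! e∈)) (≈-sym (+-assoc _ _ _))
    ... | false = sumOver-update is! e∈

  module EdgeMatrix (G : Graph) (o : Orientation G) where
    open Graph G
    open Orientation o
    open Potentials G using (potential; one)
    open Oriented G o using (tail≢head; entry)

    touches? : ∀ z u → Dec ([ (λ v → u ≡ v) , (λ e → Incident u e) ]′ z)
    touches? (inj₁ v) u = u ≟ v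
    touches? (inj₂ e) u = incident? u e

    -- There are no loops, so the two indicators of an edge are never both 1.
    potential-touches : ∀ z u → potential z u ≡ indicator (touches? z u)
    potential-touches (inj₁ v) u = refl
    potential-touches (inj₂ e) u with u ≟ end₁ e | u ≟ end₂ e
    ... | yes p | yes q = contradiction (trans (sym p) q) (loopless e)
    ... | yes _ | no  _ = refl
    ... | no  _ | yes _ = refl
    ... | no  _ | no  _ = refl

    signed : ∀ {p q} {P : Set p} {Q : Set q} (P? : Dec P) (Q? : Dec Q) → ¬ (P × Q) →
             (if does P? then 1# else if does Q? then - 1# else 0#) ≈ ι (indicator P? ℤ.- indicator Q?)
    signed (yes p) (yes q) ¬pq = contradiction (p , q) ¬pq
    signed (yes _) (no _)  _   = ≈-sym ι-1
    signed (no _)  (yes _) _   = -‿cong (≈-sym ι-1)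
    signed (no _)  (no _)  _   = ≈-sym ι-0

    -- The nested conditional is a difference of indicators unless both conditions hold. A vertex is
    -- not both ends of `e`, and an edge `f ≢ e` meeting both ends would be parallel to `e`. For
    -- `f ≡ e` the difference is 1 - 1, which matches the entry 0.
    edgeMatrix≈ι : ∀ e z → edgeMatrix ℝ G o e z ≈ ι (entry e (one z))
    edgeMatrix≈ι e (inj₁ v) = ≈-trans
      (signed (v ≟ head e) (v ≟ tail e) λ (h , t) → tail≢head e (trans (sym t) h))
      (reflexive (cong ι (cong₂ ℤ._-_
        (indicator-cong (v ≟ head e) (head e ≟ v) sym sym)
        (indicator-cong (v ≟ tail e) (tail e ≟ v) sym sym))))
    edgeMatrix≈ι e (inj₂ f) = ≈-trans on
      (reflexive (sym (cong ι (cong₂ ℤ._-_ (potential-touches (inj₂ f) (head e)) (potential-touches (inj₂ f) (tail e))))))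
      where
      head∈e : Incident (head e) e
      head∈e with joins e
      ... | inj₁ (_ , q) = inj₂ (sym q)
      ... | inj₂ (p , _) = inj₁ (sym p)

      tail∈e : Incident (tail e) e
      tail∈e with joins e
      ... | inj₁ (p , _) = inj₁ (sym p)
      ... | inj₂ (_ , q) = inj₂ (sym q)

      parallel : Incident (head e) f → Incident (tail e) f → Joins f (tail e) (head e)
      parallel (inj₁ h) (inj₁ t) = contradiction (trans t (sym h)) (tail≢head e)
      parallel (inj₁ h) (inj₂ t) = inj₂ (sym h , sym t)
      parallel (inj₂ h) (inj₁ t) = inj₁ (sym t , sym h)
      parallel (inj₂ h) (inj₂ t) = contradiction (trans t (sym h)) (tail≢head e)

      on : edgeMatrix ℝ G o e (inj₂ f) ≈ ι (indicator (incident? (head e) f) ℤ.- indicator (incident? (tail e) f))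
      on with f ≟ e
      ... | yes refl = reflexive (sym (cong ι (cong₂ ℤ._-_
        (indicator-yes (incident? (head e) e) head∈e)
        (indicator-yes (incident? (tail e) e) tail∈e))))
      ... | no f≢e = signed (incident? (head e) f) (incident? (tail e) f)
        λ (h , t) → f≢e (noParallel (parallel h t) (joins e))

    update : Weighting ℝ G → V ⊎ E → Carrier → Weighting ℝ G
    update f z x w = if does (w ≟ⱽᴱ z) then x else f w

    vertexSum-update : ∀ f z x u →
      vertexSum ℝ G (update f z x) u ≈ vertexSum ℝ G f u + ι (potential z u) * (x - f z)
    vertexSum-update f (inj₂ e) x u = ≈-trans
      (+-congˡ (≈-trans
        (sumOver-update (incident? u) (f ∘ inj₂) e x (Unique.allFin⁺ size) (∈-allFin e))
        (+-congˡ (*-congʳ (reflexive (cong ι (sym (potential-touches (inj₂ e) u))))))))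
      (≈-sym (+-assoc _ _ _))
    vertexSum-update f (inj₁ v) x u with u ≟ v
    ... | no _     = ≈-sym (≈-trans (+-congˡ (zeroˡ _)) (+-identityʳ _))
    ... | yes refl = begin
      x + rest                              ≈⟨ +-congʳ (+-identityˡ x) ⟨
      (0# + x) + rest                       ≈⟨ +-congʳ (+-congʳ (-‿inverseʳ (f (inj₁ u)))) ⟨
      ((f (inj₁ u) - f (inj₁ u)) + x) + rest ≈⟨ +-congʳ (≈-trans (+-assoc _ _ _) (+-congˡ (+-comm _ _))) ⟩
      (f (inj₁ u) + (x - f (inj₁ u))) + rest ≈⟨ +-swapʳ _ _ _ ⟩
      (f (inj₁ u) + rest) + (x - f (inj₁ u)) ≈⟨ +-congˡ (≈-trans (*-congʳ ι-1) (*-identityˡ _)) ⟨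
      (f (inj₁ u) + rest) + ι 1ℤ * (x - f (inj₁ u)) ∎
      where rest = sumOver ℝ (filter (incident? u) (allFin size)) (f ∘ inj₂)

    gap : Weighting ℝ G → E → Carrier
    gap f e = vertexSum ℝ G f (head e) - vertexSum ℝ G f (tail e)

    -- The link between weightings and the matrix: gaps are affine in each weight, with the entries
    -- of `A_G` as slopes.
    gap-update : ∀ f z x e → gap (update f z x) e ≈ gap f e + ι (entry e (one z)) * (x - f z)
    gap-update f z x e = begin
      gap (update f z x) e
        ≈⟨ +-cong (vertexSum-update f z x (head e)) (-‿cong (vertexSum-update f z x (tail e))) ⟩
      (H + ι p * d) - (T + ι q * d)          ≈⟨ +-congˡ (-‿+-comm _ _) ⟨
      (H + ι p * d) + (- T - ι q * d)        ≈⟨ +-medial _ _ _ _ ⟩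
      (H - T) + (ι p * d - ι q * d)          ≈⟨ +-congˡ (+-congˡ (-‿distribˡ-* _ _)) ⟩
      (H - T) + (ι p * d + - ι q * d)        ≈⟨ +-congˡ (distribʳ _ _ _) ⟨
      (H - T) + (ι p - ι q) * d              ≈⟨ +-congˡ (*-congʳ (≈-trans (ι-+ p (ℤ.- q)) (+-congˡ (ι-neg q)))) ⟨
      (H - T) + ι (p ℤ.- q) * d              ∎
      where
      H = vertexSum ℝ G f (head e)
      T = vertexSum ℝ G f (tail e)
      p = potential z (head e)
      q = potential z (tail e)
      d = x - f z

    -- Choosing between two values for each weight.

    module _ (low high : Weighting ℝ G) where

      Between : Weighting ℝ G → Set ℓ₁
      Between f = ∀ z → f z ≈ low z ⊎ f z ≈ high z

      step : E → V ⊎ E → Carrier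
      step e z = ι (entry e (one z)) * (high z - low z)

      -- The alternating sum is the difference of those with `z` at its high and at its low value.
      -- If it is apart from 0, the two are apart from each other, and by cotransitivity one of them
      -- is apart from 0; that value is kept. With all columns treated, the product of the gaps is
      -- apart from 0, and so is each gap. `f` is the weighting reached so far and `c` its gaps.
      nonvanishing : ∀ f c zs → Unique zs → (∀ {z} → z ∈ zs → f z ≈ low z) → Between f →
        (∀ e → c e ≈ gap f e) → alternating step (allFin size) c zs # 0# →
        ∃ λ f′ → Between f′ × (∀ e → gap f′ e # 0#)
      nonvanishing f c [] _ _ between c≈gap alt#0 = f , between ,
        λ e → #-congʳ (c≈gap e) (listProduct#0⁻ c (∈-allFin e) alt#0)
      nonvanishing f c (z ∷ zs) (z∉ ∷ zs!) onLow between c≈gap alt#0 with #-cotrans (-#0⇒# alt#0) 0#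
      ... | inj₂ 0#alt = nonvanishing f c zs zs! (onLow ∘ there) between c≈gap (#-sym 0#alt)
      ... | inj₁ alt#0′ = nonvanishing f′ (shifted step c z) zs zs! onLow′ between′ c′≈gap alt#0′
        where
        f′ : Weighting ℝ G
        f′ = update f z (high z)

        f′-other : ∀ {w} → w ≢ z → f′ w ≈ f w
        f′-other {w} w≢z with w ≟ⱽᴱ z
        ... | yes w≡z = contradiction w≡z w≢z
        ... | no  _   = ≈-refl

        onLow′ : ∀ {w} → w ∈ zs → f′ w ≈ low w
        onLow′ w∈ = ≈-trans (f′-other (All.lookup z∉ w∈ ∘ sym)) (onLow (there w∈))

        between′ : Between f′
        between′ w with w ≟ⱽᴱ z
        ... | yes refl = inj₂ ≈-refl
        ... | no  _    = between w

        c′≈gap : ∀ e → shifted step c z e ≈ gap f′ e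
        c′≈gap e = ≈-trans
          (+-cong (c≈gap e) (*-congˡ (+-congˡ (-‿cong (≈-sym (onLow (here refl)))))))
          (≈-sym (gap-update f z (high z) e))

  -- Permanent index and choosability of 2-trees.

  module _ (G : Graph) (T : IsTwoTree G) where
    open Graph G
    open IsTwoTree T
    open TwoTrees G T using (indexEntry; minor; distinctIndices)

    permanentIndex : ∀ o → PermanentIndex ℝ _≟ⱽᴱ_ (edgeMatrix ℝ G o) [ 1 ]
    permanentIndex o with distinctIndices o
    ... | κ , κ-injective , per≢0 =
      (κ , #-congʳ (≈-sym permanent≈ι) (ι#0 per≢0) ,
        λ z → countFin≤1 (λ j → κ j ≟ⱽᴱ z) λ p q → κ-injective (trans p (sym q))) ,
      -- Minimality of 1: the edge between `v₀` and `v₁` is a row, so `κ′` has a value there, and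
      -- this column is used at least once.
      λ { k (κ′ , _ , count) → ℕ.≤-trans
            (filter-some (λ j → κ′ j ≟ⱽᴱ κ′ (proj₁ v₀v₁))
              (lose {P = λ j → κ′ j ≡ κ′ (proj₁ v₀v₁)} (∈-allFin (proj₁ v₀v₁)) refl))
            (count (κ′ (proj₁ v₀v₁))) }
      where
      permanent≈ι : permanent ℝ (λ i j → edgeMatrix ℝ G o i (κ j)) ≈
                    ι (minor o κ)
      permanent≈ι = begin
        permanent ℝ (λ i j → edgeMatrix ℝ G o i (κ j))
          ≈⟨ permanent≈per (edgeMatrix ℝ G o) id κ ⟩
        per (edgeMatrix ℝ G o) (allFin size) (tabulate κ)
          ≈⟨ per-pointwise {_∼₁_ = _≡_} {_≡_} {edgeMatrix ℝ G o} {λ e z → ι (indexEntry o e z)}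
               (λ { {e} {y = z} refl refl → EdgeMatrix.edgeMatrix≈ι G o e z })
               {allFin size} (Pointwise.refl refl) (Pointwise.refl refl) ⟩
        per (λ e z → ι (indexEntry o e z)) (allFin size) (tabulate κ)
          ≈⟨ ι-per (indexEntry o) (allFin size) (tabulate κ) ⟨
        ι (minor o κ) ∎

    open EdgeMatrix G orientation using (gap; step; Between; nonvanishing)

    -- Every weight starts at the first element of its set, and only those indexed by `κ` may move
    -- to the second. The alternating sum of products of gaps is the permanent times the product of
    -- the spreads, each factor being apart from 0.
    choosable : Choosable ℝ G 2 2
    choosable Lⱽ Lᴱ with distinctIndices orientation
    ... | κ , κ-injective , per≢0 = result
      (nonvanishing low high low (gap low) (tabulate κ)
        (Unique.tabulate⁺ κ-injective) (λ _ → ≈-refl) (λ _ → inj₁ ≈-refl) (λ _ → ≈-refl)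
        (#-congʳ (≈-sym alternating≈) (x#0y#0→xy#0 (ι#0 per≢0) (listProduct#0 spread (tabulate κ) spread#0))))
      where
      available : V ⊎ E → RealSet ℝ G 2
      available = [ Lⱽ , Lᴱ ]′

      low high spread : Weighting ℝ G
      low z = RealSet.element (available z) zero
      high z = RealSet.element (available z) (suc zero)
      spread z = high z - low z

      spread#0 : ∀ z → spread z # 0#
      spread#0 z = #⇒-#0 (RealSet.distinct (available z) λ ())

      alternating≈ : alternating (step low high) (allFin size) (gap low) (tabulate κ) ≈
        ι (minor orientation κ) *
        listProduct spread (tabulate κ)
      alternating≈ = begin
        alternating (step low high) (allFin size) (gap low) (tabulate κ)
          ≈⟨ alternating≈per _ (allFin size) _ (tabulate κ) (trans (length-tabulate id) (sym (length-tabulate κ))) ⟩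
        per (step low high) (allFin size) (tabulate κ)
          ≈⟨ per-scaleColumns (λ e z → ι (indexEntry orientation e z)) spread (allFin size) (tabulate κ) ⟩
        per (λ e z → ι (indexEntry orientation e z)) (allFin size) (tabulate κ) * listProduct spread (tabulate κ)
          ≈⟨ *-congʳ (ι-per (indexEntry orientation) (allFin size) (tabulate κ)) ⟨
        ι (minor orientation κ) *
        listProduct spread (tabulate κ) ∎

      result : (∃ λ f → Between low high f × (∀ e → gap f e # 0#)) →
        Σ (Weighting ℝ G) λ f →
          (∀ v → ∃ λ i → f (inj₁ v) ≈ RealSet.element (Lⱽ v) i) ×
          (∀ e → ∃ λ i → f (inj₂ e) ≈ RealSet.element (Lᴱ e) i) × Proper ℝ G f
      result (f , between , gap#0) = f , (member ∘ inj₁) , (member ∘ inj₂) , proper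
        where
        member : ∀ z → ∃ λ i → f z ≈ RealSet.element (available z) i
        member z with between z
        ... | inj₁ f≈low  = zero , f≈low
        ... | inj₂ f≈high = suc zero , f≈high

        proper : Proper ℝ G f
        proper (e , j) with Oriented.joins⇒arc G orientation j
        ... | inj₁ (refl , refl) = #-sym (-#0⇒# (gap#0 e))
        ... | inj₂ (refl , refl) = -#0⇒# (gap#0 e)

corollary3 : ∀ {c ℓ₁ ℓ₂ ℓ₃} (ℝ : RealNumbers c ℓ₁ ℓ₂ ℓ₃) (G : Graph) → IsTwoTree G →
    ((o : Orientation G) → PermanentIndex ℝ (Graph._≟ⱽᴱ_ G) (edgeMatrix ℝ G o) [ 1 ]) × Choosable ℝ G 2 2
corollary3 ℝ G T = permanentIndex ℝ G T , choosable ℝ G T
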